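{- Let $d \geq 2$ be an integer, and let $q \equiv 1 \pmod {d}$ be an odd power of a prime $p$. Let $H=(\mathbb{F}_q^*)^d$, let $g$ be a primitive root of $\mathbb{F}_q$ (a generator of $\mathbb{F}_q^*$), and let $I \subseteq \mathbb{Z}/d\mathbb{Z}$ be an index set. Consider the graph $X=\operatorname{Cay}(\mathbb{F}_q^+; S_{d,I})$, where $S_{d, I}=\bigcup_{i \in I} g^i H$ satisfies $S_{d,I}=-S_{d,I}$. If $I-I \neq \mathbb{Z}/d\mathbb{Z}$, then $$\omega(X) \leq \sqrt{\frac{|I-I|\,q}{d}}+\sqrt{\frac{q}{p}}.$$ In particular, if additionally $q\equiv 1 \pmod {2d}$ in the case that $q$ is odd, then $\omega(GP(q,d))\leq \sqrt{q/d}+\sqrt{q/p}$.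
   Context: $\mathbb{F}_q$ is the finite field with $q$ elements, $\mathbb{F}_q^+$ its additive group, and $\mathbb{F}_q^*=\mathbb{F}_q\setminus\{0\}$. An odd power of $p$ means $p^{2r+1}$ with $r\ge 0$ an integer. $(\mathbb{F}_q^*)^d=\{x^d: x\in\mathbb{F}_q^*\}$; since this subgroup has index $d$ in $\mathbb{F}_q^*$, the coset $g^iH$ is well defined for $i\in\mathbb{Z}/d\mathbb{Z}$. $I-I=\{i-j: i,j\in I\}\subseteq \mathbb{Z}/d\mathbb{Z}$. For $S\subseteq\mathbb{F}_q^*$ with $S=-S$ (where $-S=\{ -s:s\in S\}$), the Cayley graph $\operatorname{Cay}(\mathbb{F}_q^+;S)$ is the graph with vertex set $\mathbb{F}_q$ in which two vertices are adjacent if and only if their difference lies in $S$. For $d>1$ and a prime power $q\equiv 1 \pmod d$, with moreover $q\equiv 1\pmod{2d}$ if $q$ is odd, the $d$-Paley graph is $GP(q,d)=\operatorname{Cay}(\mathbb{F}_q^+;(\mathbb{F}_q^*)^d)$. The clique number $\omega(X)$ of a graph $X$ is the maximum number of vertices of a complete subgraph of $X$. -}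

module Defs where

open import Algebra.Apartness.Bundles using (HeytingCommutativeRing; HeytingField)
open import Algebra.Bundles using (CommutativeRing)
import Algebra.Properties.Semiring.Exp as Exp
open import Data.Fin.Base using (Fin; zero; suc; toℕ)
open import Data.Fin.Properties using (any?; all?; injective⇒≤; _≟_)
open import Data.Fin.Subset using (Subset; _∈_)
open import Data.Fin.Subset.Properties using (_∈?_)
open import Data.Integer.Base using (+_)
open import Data.Nat.Base using (ℕ; zero; suc; _+_; _∸_; _≤_; NonZero; s≤s⁻¹)
open import Data.Nat.DivMod using (_mod_)
open import Data.Nat.Properties using (m≤n⇒m<n∨m≡n)
open import Data.Product.Base using (∃; ∃-syntax; Σ-syntax; _×_; _,_; proj₁; proj₂)
open import Data.Rational.Base as ℚ using (ℚ; 0ℚ)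
open import Data.Sum.Base using (inj₁; inj₂)
open import Data.Vec.Base using (Vec; []; _∷_; lookup; tabulate)
open import Data.Vec.Properties using (lookup∘tabulate)
open import Function.Base using (_∘_)
open import Function.Bundles using (Inverse)
open import Level using (Level; _⊔_; 0ℓ) renaming (suc to lsuc)
open import Relation.Binary.Bundles using (Setoid)
open import Relation.Binary.Core using (Rel)
open import Relation.Binary.Definitions using (_Respects_; _Respects₂_) renaming (Decidable to Decidable₂)
open import Relation.Binary.PropositionalEquality as ≡ using (_≡_; _≢_)
open import Relation.Nullary.Decidable using (Dec; yes; no; map′; ¬?; _×-dec_; _→-dec_; does; decidable-stable)
open import Relation.Nullary.Negation using (¬_; contradiction)
open import Relation.Unary using (Pred; Decidable; _⊆_)

private
  variable
    a ℓ p c ℓ₁ ℓ₂ : Level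

------------------------------------------------------------------------
-- Finite setoids and their decidable subsets

-- A has exactly n elements up to ≈.
HasSize : Setoid a ℓ → ℕ → Set (a ⊔ ℓ)
HasSize A n = Inverse A (≡.setoid (Fin n))

record DecSubset (A : Setoid a ℓ) p : Set (a ⊔ ℓ ⊔ lsuc p) where
  open Setoid A
  field
    Mem  : Pred Carrier p
    resp : Mem Respects _≈_
    mem? : Decidable Mem

module _ {A : Setoid a ℓ} {n : ℕ} (A↔n : HasSize A n) where
  open Setoid A
  open Inverse A↔n

  ≈-dec : Decidable₂ _≈_
  ≈-dec x y = map′
    (λ eq → trans (sym (inverseʳ ≡.refl)) (trans (from-cong eq) (inverseʳ ≡.refl)))
    to-cong (to x ≟ to y)

  any-dec : {P : Pred Carrier p} → P Respects _≈_ → Decidable P → Dec (∃ P)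
  any-dec resp P? = map′
    (λ (i , Pi) → from i , Pi)
    (λ (x , Px) → to x , resp (sym (inverseʳ ≡.refl)) Px)
    (any? (P? ∘ from))

------------------------------------------------------------------------
-- Finite graphs and the clique number

-- Only the adjacency relation is recorded.  For the Cayley graphs below,
-- symmetry of Adj is the condition S = -S on the connection set, which is a
-- hypothesis where it is needed.
record FiniteGraph a ℓ p : Set (lsuc (a ⊔ ℓ ⊔ p)) where
  field
    vertices : Setoid a ℓ
    order    : ℕ
    finite   : HasSize vertices order
  open Setoid vertices public using (_≈_) renaming (Carrier to Vertex)
  field
    Adj      : Rel Vertex p
    Adj-resp : Adj Respects₂ _≈_
    Adj?     : Decidable₂ Adj

module _ (X : FiniteGraph a ℓ p) where
  open FiniteGraph X
  private
    module V = Setoid vertices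
    module E = Inverse finite

  IsClique : ∀ {m} → Pred (Fin m → Vertex) (ℓ ⊔ p)
  IsClique f = ∀ i j → i ≢ j → ¬ (f i ≈ f j) × Adj (f i) (f j)

  HasClique : ℕ → Set (a ⊔ ℓ ⊔ p)
  HasClique m = Σ[ f ∈ (Fin m → Vertex) ] IsClique f

  IsCliqueNumber : ℕ → Set (a ⊔ ℓ ⊔ p)
  IsCliqueNumber n = HasClique n × (∀ m → HasClique m → m ≤ n)

  private
    anyVec? : ∀ {k m q} {P : Pred (Vec (Fin k) m) q} → Decidable P → Dec (∃ P)
    anyVec? {m = zero}  P? = map′ (λ P[] → [] , P[]) (λ { ([] , P[]) → P[] }) (P? [])
    anyVec? {m = suc m} P? = map′
      (λ (i , v , Piv) → (i ∷ v) , Piv)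
      (λ { ((i ∷ v) , Piv) → i , v , Piv })
      (any? λ i → anyVec? λ v → P? (i ∷ v))

    isClique? : ∀ {m} → Decidable (IsClique {m})
    isClique? f = all? λ i → all? λ j →
      ¬? (i ≟ j) →-dec (¬? (≈-dec finite (f i) (f j)) ×-dec Adj? (f i) (f j))

    resp-clique : ∀ {m} {f g : Fin m → Vertex} → (∀ i → f i ≈ g i) → IsClique f → IsClique g
    resp-clique f≈g cl i j i≢j with cl i j i≢j
    ... | fi≉fj , adj =
      (λ gi≈gj → fi≉fj (V.trans (f≈g i) (V.trans gi≈gj (V.sym (f≈g j))))) ,
      proj₁ Adj-resp (f≈g j) (proj₂ Adj-resp (f≈g i) adj)

    hasClique? : Decidable HasClique
    hasClique? m = map′
      (λ (v , cl) → (E.from ∘ lookup v) , cl)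
      (λ (f , cl) → tabulate (E.to ∘ f) ,
        resp-clique (λ i → V.sym (E.inverseʳ (lookup∘tabulate (E.to ∘ f) i))) cl)
      (anyVec? (λ v → isClique? (E.from ∘ lookup v)))

    clique-bound : ∀ m → HasClique m → m ≤ order
    clique-bound m (f , cl) = injective⇒≤ {f = E.to ∘ f} inj
      where
      inj : ∀ {i j} → E.to (f i) ≡ E.to (f j) → i ≡ j
      inj {i} {j} eq = decidable-stable (i ≟ j) λ i≢j →
        proj₁ (cl i j i≢j)
          (V.trans (V.sym (E.inverseʳ ≡.refl)) (V.trans (E.from-cong eq) (E.inverseʳ ≡.refl)))

    greatest : ∀ b → (∀ m → HasClique m → m ≤ b) → ∃ IsCliqueNumber
    greatest b bound with hasClique? b
    ... | yes cl = b , cl , bound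
    greatest zero    bound | no ¬cl = contradiction ((λ ()) , λ ()) ¬cl
    greatest (suc b) bound | no ¬cl = greatest b bound′
      where
      bound′ : ∀ m → HasClique m → m ≤ b
      bound′ m cl with m≤n⇒m<n∨m≡n (bound m cl)
      ... | inj₁ m<1+b  = s≤s⁻¹ m<1+b
      ... | inj₂ ≡.refl = contradiction cl ¬cl

  cliqueNumber : ∃ IsCliqueNumber
  cliqueNumber = greatest order clique-bound

  ω : ℕ
  ω = proj₁ cliqueNumber

------------------------------------------------------------------------
-- Finite fields and Cayley graphs on their additive groups

-- Over a finite carrier, x ≉ y implies that x - y is invertible, so a Heyting
-- field with finitely many elements is a field in the usual sense.
record FiniteField c ℓ₁ ℓ₂ (q : ℕ) : Set (lsuc (c ⊔ ℓ₁ ⊔ ℓ₂)) where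
  field
    heytingField : HeytingField c ℓ₁ ℓ₂
  open HeytingField heytingField using (heytingCommutativeRing)
  open HeytingCommutativeRing heytingCommutativeRing using (commutativeRing) public
  open CommutativeRing commutativeRing public
    hiding (zero) renaming (_+_ to _+F_; _*_ to _*F_; -_ to -F_; _-_ to _-F_)
  open Exp semiring public using () renaming (_^_ to _^F_)
  field
    size : HasSize setoid q

module _ {q : ℕ} (F : FiniteField c ℓ₁ ℓ₂ q) where
  open FiniteField F
  open Exp semiring using (^-congˡ)

  Units : Pred Carrier ℓ₁
  Units x = ¬ (x ≈ 0#)

  -- Natural exponents suffice, the multiplicative group being finite.
  IsPrimitiveRoot : Pred Carrier (c ⊔ ℓ₁)
  IsPrimitiveRoot g = Units g × (∀ x → Units x → ∃[ n ] x ≈ g ^F n)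

  -- The set -S.
  negation : Pred Carrier p → Pred Carrier (c ⊔ ℓ₁ ⊔ p)
  negation S x = ∃[ s ] S s × x ≈ -F s

  Cay : DecSubset setoid p → FiniteGraph c ℓ₁ p
  Cay S = record
    { vertices = setoid
    ; order    = q
    ; finite   = size
    ; Adj      = λ x y → Mem (x -F y)
    ; Adj-resp = (λ y≈z → resp (+-cong refl (-‿cong y≈z)))
               , (λ y≈z → resp (+-cong y≈z refl))
    ; Adj?     = λ x y → mem? (x -F y)
    }
    where open DecSubset S

  powers : ℕ → DecSubset setoid (c ⊔ ℓ₁)
  powers d = record
    { Mem  = λ y → ∃[ x ] Units x × y ≈ x ^F d
    ; resp = λ y≈z (x , x≉0 , y≈) → x , x≉0 , trans (sym y≈z) y≈
    ; mem? = λ y → any-dec size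
        (λ u≈v (u≉0 , y≈) → (λ v≈0 → u≉0 (trans u≈v v≈0)) , trans y≈ (^-congˡ d u≈v))
        (λ x → ¬? (≈-dec size x 0#) ×-dec ≈-dec size y (x ^F d))
    }

  -- The union of the cosets gⁱH for i ∈ I, where H is the group of d-th powers.
  -- The representative of i ∈ ℤ/d in {0,…,d-1} is used as the exponent of g.
  cosets : (d : ℕ) → Carrier → Subset d → DecSubset setoid (c ⊔ ℓ₁)
  cosets d g I = record
    { Mem  = λ y → ∃[ i ] i ∈ I × ∃[ h ] H.Mem h × y ≈ (g ^F toℕ i) *F h
    ; resp = λ y≈z (i , i∈I , h , h∈H , y≈) → i , i∈I , h , h∈H , trans (sym y≈z) y≈
    ; mem? = λ y → any? λ i → (i ∈? I) ×-dec any-dec size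
        (λ u≈v (u∈H , y≈) → H.resp u≈v u∈H , trans y≈ (*-cong refl u≈v))
        (λ h → H.mem? h ×-dec ≈-dec size y ((g ^F toℕ i) *F h))
    }
    where module H = DecSubset (powers d)

  -- Meaningful as an undirected graph when d ∣ q - 1, and 2d ∣ q - 1 for odd q.
  GP : ℕ → FiniteGraph c ℓ₁ (c ⊔ ℓ₁)
  GP d = Cay (powers d)

------------------------------------------------------------------------
-- ℤ/d, represented by Fin d

module _ {d : ℕ} .{{_ : NonZero d}} where

  infixl 6 _⊖_
  _⊖_ : Fin d → Fin d → Fin d
  i ⊖ j = (toℕ i + (d ∸ toℕ j)) mod d

  differences : Subset d → Subset d
  differences I = tabulate λ k → does
    (any? λ i → any? λ j → (i ∈? I) ×-dec (j ∈? I) ×-dec (k ≟ i ⊖ j))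

------------------------------------------------------------------------
-- Real bounds

-- A real number is given by its open upper cut, the set of rationals strictly
-- greater than it.  On such cuts x ≤ y is reverse inclusion and the sum is the
-- elementwise sum.
ℝᵘ : Set₁
ℝᵘ = Pred ℚ 0ℓ

-- n as a real number.
⌜_⌝ : ℕ → ℝᵘ
⌜ n ⌝ s = (+ n) ℚ./ 1 ℚ.< s

-- The square root of x ≥ 0: since s ≥ 0, the condition x < s² says √x < s.
√ : ℚ → ℝᵘ
√ x s = (0ℚ ℚ.≤ s) × (x ℚ.< s ℚ.* s)

infixl 6 _+ᵘ_
_+ᵘ_ : ℝᵘ → ℝᵘ → ℝᵘ
(x +ᵘ y) s = ∃[ u ] ∃[ v ] x u × y v × s ≡ u ℚ.+ v

infix 4 _≤ᵘ_
_≤ᵘ_ : ℝᵘ → ℝᵘ → Set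
x ≤ᵘ y = y ⊆ x

{-# OPTIONS --safe #-}

-- Write P = pʳ and let A be a clique with n elements.  A quotient of two differences of A lies in a union of
-- |I - I| cosets of the d-th powers, so its power with exponent m = (q - 1) / d takes at most |I - I| values.
-- For a value y which is not such a quotient the points b + a y with a, b ∈ A are distinct, and the divided
-- differences of X^q = X at three or more of them vanish.  Such a divided difference is a polynomial in y, and the
-- values of y excluded are roots of a polynomial of degree N = |I - I| m.  Comparing degrees, the divided differences
-- vanish at y = 0 as soon as they involve N + 3 points.  There the points collapse to the elements of A, each with
-- multiplicity n.  Taking multiplicities divisible by P, the Frobenius map turns these into divided differences of X^Q,
-- Q = p P, at the distinct points aᴾ with multiplicity about n / P.  As X^Q has derivative 0, they still vanish when the
-- multiplicity is increased up to p - 1; but a divided difference of X^Q at Q + 1 points is 1, and P < n makes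
-- Q + 1 points available.  Hence n ≤ P or (n - P)² ≤ N.
module Submission where

open import Defs
open import Algebra.Apartness.Bundles using (HeytingField)
open import Algebra.Bundles using (CommutativeRing)
import Algebra.Properties.CommutativeMonoid.Mult as CMult
import Algebra.Properties.CommutativeMonoid.Sum as Sum
import Algebra.Properties.CommutativeSemiring.Exp as CExp
import Algebra.Properties.Ring as RingProperties
import Algebra.Properties.Semiring.Exp as Exp
import Algebra.Properties.Semiring.Mult as Mult
import Algebra.Solver.Ring.NaturalCoefficients.Default as Solver
open import Data.Bool.Base using (true; false)
open import Data.Fin.Base using (Fin; zero; suc; toℕ; punchIn; inject≤; combine)
import Data.Fin.Permutation as Perm
open import Data.Fin.Properties as Finₚ using (_≟_; any?)
open import Data.Fin.Subset using (Subset; ⊤; ∣_∣; _∈_)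
open import Data.Fin.Subset.Properties using (_∈?_; ∣p∣≤n; ∣p∣≡n⇒p≡⊤)
open import Data.Integer.Base as ℤ using (+_; +≤+)
import Data.Integer.Properties as ℤₚ
import Data.Integer.Solver as ℤSolver
open import Data.List.Base using (List; []; _∷_; _++_; [_]; length; map; replicate; foldr; concat; take; tabulate; allFin; cartesianProduct)
open import Data.List.Membership.Propositional using (lose) renaming (_∈_ to _∈ₗ_)
open import Data.List.Membership.Propositional.Properties using (∈-map⁺)
open import Data.List.Properties using (++-assoc; ++-identityʳ; length-++; length-++-sucʳ; length-map; length-replicate; length-tabulate; length-take; map-++; map-∘; map-tabulate)
open import Data.List.Relation.Unary.All as All using (All; []; _∷_)
import Data.List.Relation.Unary.All.Properties as Allₚ
open import Data.List.Relation.Unary.AllPairs as AllPairs using (AllPairs; []; _∷_)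
import Data.List.Relation.Unary.AllPairs.Properties as AllPairsₚ
open import Data.List.Relation.Unary.Any as Any using (Any; here; there)
import Data.List.Relation.Unary.Any.Properties as Anyₚ
open import Data.List.Relation.Unary.Unique.Propositional using (Unique)
import Data.List.Relation.Unary.Unique.Propositional.Properties as Uniqueₚ
open import Data.Nat.Base as ℕ using (ℕ; zero; suc; NonZero; _∸_; z≤n; s≤s; z<s; s<s; s≤s⁻¹)
open import Data.Nat.Coprimality using (coprime-Bézout; prime⇒coprime)
open import Data.Nat.Divisibility using (_∣_; _∤_; divides)
open import Data.Nat.DivMod using (_%_; m≡m%n+[m/n]*n; m%n<n; m<n*o⇒m/o<n; /-monoˡ-≤; m*n/n≡m; m/n*n≤m)
open import Data.Nat.GCD using (module Bézout)
open import Data.Nat.Primality using (Prime; prime⇒nonZero; prime⇒nonTrivial)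
import Data.Nat.Properties as ℕₚ
import Data.Nat.Solver as ℕSolver
open import Data.Product.Base using (Σ-syntax; ∃-syntax; _×_; _,_; proj₁; proj₂)
open import Data.Rational.Base as ℚ using (ℚ)
import Data.Rational.Properties as ℚₚ
open import Data.Rational.Unnormalised.Base as ℚᵘ using (mkℚᵘ; *≡*; *≤*)
import Data.Rational.Unnormalised.Properties as ℚᵘₚ
open import Data.Sum.Base using (inj₁; inj₂)
open import Data.Vec.Base using ([]; _∷_; here; there)
open import Data.Vec.Properties using (lookup∘tabulate; lookup⇒[]=)
open import Function.Base using (_∘_; _$_; id)
open import Function.Bundles using (Inverse)
open import Level using (_⊔_)
open import Relation.Binary.PropositionalEquality as ≡ using (_≡_; _≢_)
open import Relation.Nullary.Decidable using (yes; no; dec-true; decidable-stable; _×-dec_)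
open import Relation.Nullary.Negation using (¬_; contradiction)
open import Relation.Unary using (_≐_)

-- Divided differences of monomials

module DividedDifference {c ℓ} (R : CommutativeRing c ℓ) where
  open CommutativeRing R hiding (zero)
  open Exp semiring using (_^_)
  open Mult semiring using (×-comm-*) renaming (_×_ to _×ₙ_)
  open CMult +-commutativeMonoid using (×-distrib-+)
  open Solver commutativeSemiring using (solve; _:+_; _:*_; _:=_)
  open import Relation.Binary.Reasoning.Setoid setoid

  -- dd K rs is the divided difference of X^K at the nodes rs, which may be repeated; the last clause is Leibniz' rule for X X^K.
  dd : ℕ → List Carrier → Carrier
  dd K       []           = 0#
  dd zero    (r ∷ [])     = 1#
  dd zero    (r ∷ _ ∷ _)  = 0#
  dd (suc K) (r ∷ rs)     = r * dd K (r ∷ rs) + dd K rs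

  -- The recursion (r - s) f[r, s, rs] = f[r, rs] - f[s, rs], without subtraction so that the semiring solver applies.
  dd-exchange : ∀ K r s rs →
    r * dd K (r ∷ s ∷ rs) + dd K (s ∷ rs) ≈ s * dd K (r ∷ s ∷ rs) + dd K (r ∷ rs)
  dd-exchange zero r s [] = +-congʳ (trans (zeroʳ r) (sym (zeroʳ s)))
  dd-exchange zero r s (_ ∷ _) = +-congʳ (trans (zeroʳ r) (sym (zeroʳ s)))
  dd-exchange (suc K) r s rs = begin
    r * (r * X + Y) + (s * Y + W) ≈⟨ solve 5 (λ r s X Y W → r :* (r :* X :+ Y) :+ (s :* Y :+ W) := r :* (r :* X :+ Y) :+ s :* Y :+ W) refl r s X Y W ⟩
    r * (r * X + Y) + s * Y + W   ≈⟨ +-congʳ (+-congʳ (*-congˡ (dd-exchange K r s rs))) ⟩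
    r * (s * X + Z) + s * Y + W   ≈⟨ solve 6 (λ r s X Y Z W → r :* (s :* X :+ Z) :+ s :* Y :+ W := s :* (r :* X :+ Y) :+ (r :* Z :+ W)) refl r s X Y Z W ⟩
    s * (r * X + Y) + (r * Z + W) ∎
    where
    X = dd K (r ∷ s ∷ rs)
    Y = dd K (s ∷ rs)
    Z = dd K (r ∷ rs)
    W = dd K rs

  -- Unfolding at the first node gives the two sides of `dd-exchange`, once the swap is known for
  -- the lower exponent.
  dd-swap : ∀ K r s rs → dd K (r ∷ s ∷ rs) ≈ dd K (s ∷ r ∷ rs)
  dd-swap zero    r s rs = refl
  dd-swap (suc K) r s rs = begin
    r * dd K (r ∷ s ∷ rs) + dd K (s ∷ rs) ≈⟨ dd-exchange K r s rs ⟩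
    s * dd K (r ∷ s ∷ rs) + dd K (r ∷ rs) ≈⟨ +-congʳ (*-congˡ (dd-swap K r s rs)) ⟩
    s * dd K (s ∷ r ∷ rs) + dd K (r ∷ rs) ∎

  -- The lengths have to agree because at exponent 0 the value depends only on the number of nodes.
  dd-prep : ∀ K r {rs ss} → length rs ≡ length ss → (∀ K → dd K rs ≈ dd K ss) → dd K (r ∷ rs) ≈ dd K (r ∷ ss)
  dd-prep zero    r {[]} {[]} eq h = refl
  dd-prep zero    r {_ ∷ _} {_ ∷ _} eq h = refl
  dd-prep (suc K) r eq h = +-cong (*-congˡ (dd-prep K r eq h)) (h K)

  dd-map-cong : ∀ {x} {X : Set x} {f g : X → Carrier} → (∀ l → f l ≈ g l) → ∀ K L → dd K (map f L) ≈ dd K (map g L)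
  dd-map-cong f≈g K       []          = refl
  dd-map-cong f≈g zero    (_ ∷ [])    = refl
  dd-map-cong f≈g zero    (_ ∷ _ ∷ _) = refl
  dd-map-cong f≈g (suc K) (l ∷ L)     =
    +-cong (*-cong (f≈g l) (dd-map-cong f≈g K (l ∷ L))) (dd-map-cong f≈g K L)

  dd-shift : ∀ K r rs ss → dd K (rs ++ r ∷ ss) ≈ dd K (r ∷ rs ++ ss)
  dd-shift K r []       ss = refl
  dd-shift K r (s ∷ rs) ss = trans
    (dd-prep K s (length-++-sucʳ rs r ss) (λ K′ → dd-shift K′ r rs ss))
    (dd-swap K s r (rs ++ ss))

  -- Each node after the first lowers the degree by one, and here there are more of these than the
  -- degree `K`.
  dd-long : ∀ K rs → suc K ℕ.< length rs → dd K rs ≈ 0#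
  dd-long K       []           _       = refl
  dd-long zero    (r ∷ [])     (s≤s ())
  dd-long zero    (r ∷ _ ∷ _)  _       = refl
  dd-long (suc K) (r ∷ rs)     (s≤s K<) = begin
    r * dd K (r ∷ rs) + dd K rs ≈⟨ +-cong (*-congˡ (dd-long K (r ∷ rs) (ℕₚ.m≤n⇒m≤1+n K<))) (dd-long K rs K<) ⟩
    r * 0# + 0#                 ≈⟨ +-identityʳ _ ⟩
    r * 0#                      ≈⟨ zeroʳ r ⟩
    0#                          ∎

  -- With `K` nodes after the first, only the leading coefficient of X^K is left.
  dd-monic : ∀ K rs → length rs ≡ suc K → dd K rs ≈ 1#
  dd-monic zero    (r ∷ [])     _  = refl
  dd-monic (suc K) (r ∷ rs) eq = begin
    r * dd K (r ∷ rs) + dd K rs ≈⟨ +-cong (*-congˡ (dd-long K (r ∷ rs) (ℕₚ.≤-reflexive (≡.sym eq)))) (dd-monic K rs (ℕₚ.suc-injective eq)) ⟩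
    r * 0# + 1#                 ≈⟨ +-congʳ (zeroʳ r) ⟩
    0# + 1#                     ≈⟨ +-identityˡ 1# ⟩
    1#                          ∎

  dd-singleton : ∀ K r → dd K (r ∷ []) ≈ r ^ K
  dd-singleton zero    r = refl
  dd-singleton (suc K) r = trans (+-identityʳ _) (*-congˡ (dd-singleton K r))

  sumOver : (Carrier → Carrier) → List Carrier → Carrier
  sumOver f = foldr (λ r acc → f r + acc) 0#

  sumOver-cong : ∀ {f g} → (∀ r → f r ≈ g r) → ∀ rs → sumOver f rs ≈ sumOver g rs
  sumOver-cong h []       = refl
  sumOver-cong h (r ∷ rs) = +-cong (h r) (sumOver-cong h rs)

  sumOver-linear : ∀ s f g rs → sumOver (λ r → s * f r + g r) rs ≈ s * sumOver f rs + sumOver g rs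
  sumOver-linear s f g []       = sym (trans (+-identityʳ _) (zeroʳ s))
  sumOver-linear s f g (r ∷ rs) = begin
    s * f r + g r + sumOver (λ r → s * f r + g r) rs ≈⟨ +-congˡ (sumOver-linear s f g rs) ⟩
    s * f r + g r + (s * F + G)                      ≈⟨ solve 5 (λ s f g F G → s :* f :+ g :+ (s :* F :+ G) := s :* (f :+ F) :+ (g :+ G)) refl s (f r) (g r) F G ⟩
    s * (f r + F) + (g r + G)                        ∎
    where
    F = sumOver f rs
    G = sumOver g rs

  sumOver-++ : ∀ f rs ss → sumOver f (rs ++ ss) ≈ sumOver f rs + sumOver f ss
  sumOver-++ f []       ss = sym (+-identityˡ _)
  sumOver-++ f (r ∷ rs) ss = trans (+-congˡ (sumOver-++ f rs ss)) (sym (+-assoc _ _ _))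

  sumOver-zero : ∀ {f} rs → All (λ r → f r ≈ 0#) rs → sumOver f rs ≈ 0#
  sumOver-zero []       []       = refl
  sumOver-zero (r ∷ rs) (z ∷ zs) = trans (+-cong z (sumOver-zero rs zs)) (+-identityˡ 0#)

  sumOver-replicate : ∀ f n r → sumOver f (replicate n r) ≈ n ×ₙ f r
  sumOver-replicate f zero    r = refl
  sumOver-replicate f (suc n) r = +-congˡ (sumOver-replicate f n r)

  -- Doubling a node gives the partial derivative in that node. The sum over all nodes is the
  -- derivative along a common translation, hence the divided difference of the derivative (K + 1)
  -- X^K.
  dd-derivative : ∀ K rs → sumOver (λ r → dd (suc K) (r ∷ rs)) rs ≈ suc K ×ₙ dd K rs
  dd-derivative-zero : ∀ rs → sumOver (λ r → dd 0 (r ∷ rs)) rs ≈ 0#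

  private
    dd-derivative-step : ∀ K s rs →
      sumOver (λ r → dd (suc K) (r ∷ s ∷ rs)) (s ∷ rs) ≈
      s * sumOver (λ r → dd K (r ∷ s ∷ rs)) (s ∷ rs) + (dd K (s ∷ rs) + sumOver (λ r → dd K (r ∷ rs)) rs)
    dd-derivative-step K s rs = begin
      sumOver (λ r → dd (suc K) (r ∷ s ∷ rs)) (s ∷ rs)                        ≈⟨ sumOver-cong (λ r → dd-swap (suc K) r s rs) (s ∷ rs) ⟩
      sumOver (λ r → s * dd K (s ∷ r ∷ rs) + dd K (r ∷ rs)) (s ∷ rs)          ≈⟨ sumOver-linear s _ _ (s ∷ rs) ⟩
      s * sumOver (λ r → dd K (s ∷ r ∷ rs)) (s ∷ rs) + sumOver (λ r → dd K (r ∷ rs)) (s ∷ rs) ≈⟨ +-congʳ (*-congˡ (sumOver-cong (λ r → dd-swap K s r rs) (s ∷ rs))) ⟩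
      s * sumOver (λ r → dd K (r ∷ s ∷ rs)) (s ∷ rs) + sumOver (λ r → dd K (r ∷ rs)) (s ∷ rs) ∎

  dd-derivative-zero []       = refl
  dd-derivative-zero (s ∷ rs) = sumOver-zero (s ∷ rs) (All.universal (λ _ → refl) (s ∷ rs))

  dd-derivative K       []       = sym (×-zeroʳ (suc K))
    where
    ×-zeroʳ : ∀ n → n ×ₙ 0# ≈ 0#
    ×-zeroʳ zero    = refl
    ×-zeroʳ (suc n) = trans (+-identityˡ _) (×-zeroʳ n)
  dd-derivative zero    (s ∷ rs) = begin
    sumOver (λ r → dd 1 (r ∷ s ∷ rs)) (s ∷ rs)  ≈⟨ dd-derivative-step 0 s rs ⟩
    s * sumOver (λ r → dd 0 (r ∷ s ∷ rs)) (s ∷ rs) + (dd 0 (s ∷ rs) + sumOver (λ r → dd 0 (r ∷ rs)) rs)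
      ≈⟨ +-cong (trans (*-congˡ (dd-derivative-zero (s ∷ rs))) (zeroʳ s)) (+-congˡ (dd-derivative-zero rs)) ⟩
    0# + (dd 0 (s ∷ rs) + 0#)                   ≈⟨ +-identityˡ _ ⟩
    dd 0 (s ∷ rs) + 0#                          ∎
  dd-derivative (suc K) (s ∷ rs) = begin
    sumOver (λ r → dd (2 ℕ.+ K) (r ∷ s ∷ rs)) (s ∷ rs) ≈⟨ dd-derivative-step (suc K) s rs ⟩
    s * sumOver (λ r → dd (suc K) (r ∷ s ∷ rs)) (s ∷ rs) + (dd (suc K) (s ∷ rs) + sumOver (λ r → dd (suc K) (r ∷ rs)) rs)
      ≈⟨ +-cong (*-congˡ (dd-derivative K (s ∷ rs))) (+-congˡ (dd-derivative K rs)) ⟩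
    s * (suc K ×ₙ dd K (s ∷ rs)) + (dd (suc K) (s ∷ rs) + suc K ×ₙ dd K rs)
      ≈⟨ +-congʳ (×-comm-* (suc K) s _) ⟩
    suc K ×ₙ (s * dd K (s ∷ rs)) + (dd (suc K) (s ∷ rs) + suc K ×ₙ dd K rs)
      ≈⟨ solve 3 (λ a b c → a :+ (b :+ c) := b :+ (a :+ c)) refl _ _ _ ⟩
    dd (suc K) (s ∷ rs) + (suc K ×ₙ (s * dd K (s ∷ rs)) + suc K ×ₙ dd K rs)
      ≈⟨ +-congˡ (×-distrib-+ _ _ (suc K)) ⟨
    dd (suc K) (s ∷ rs) + suc K ×ₙ dd (suc K) (s ∷ rs) ∎

  dd-derivative-0 : ∀ K rs → (∀ x → K ×ₙ x ≈ 0#) → sumOver (λ r → dd K (r ∷ rs)) rs ≈ 0#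
  dd-derivative-0 zero    rs _     = dd-derivative-zero rs
  dd-derivative-0 (suc K) rs K×≈0  = trans (dd-derivative K rs) (K×≈0 _)

-- Divided differences over a ring without zero divisors

NoZeroDivisors : ∀ {c ℓ} → CommutativeRing c ℓ → Set (c ⊔ ℓ)
NoZeroDivisors R = ∀ {x y} → ¬ x ≈ 0# → x * y ≈ 0# → y ≈ 0#
  where open CommutativeRing R

module Exchange {c ℓ} (R : CommutativeRing c ℓ) (*-cancel-0 : NoZeroDivisors R) where
  open CommutativeRing R hiding (zero)
  open RingProperties ring
  open Solver commutativeSemiring using (solve; _:+_; _:*_; _:=_)
  open import Relation.Binary.Reasoning.Setoid setoid
  open DividedDifference R

  -- Both equations make r - s times the unknown equal to b - a, and r - s can be cancelled.
  exchange-cancel : ∀ {r s x y a b} → ¬ r ≈ s → r * x + a ≈ s * x + b → r * y + a ≈ s * y + b → x ≈ y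
  exchange-cancel {r} {s} {x} {y} {a} {b} r≉s ex ey =
    x∙y⁻¹≈ε⇒x≈y x y (*-cancel-0 (r≉s ∘ x∙y⁻¹≈ε⇒x≈y r s) (begin
      (r - s) * (x - y)                              ≈⟨ expand ⟩
      (r * x + s * y) + - (s * x + r * y)            ≈⟨ x≈y⇒x∙y⁻¹≈ε (+-cancelʳ (a + b) _ _ cross) ⟩
      0#                                             ∎))
    where
    cross : r * x + s * y + (a + b) ≈ s * x + r * y + (a + b)
    cross = begin
      r * x + s * y + (a + b)     ≈⟨ solve 4 (λ u v a b → u :+ v :+ (a :+ b) := (u :+ a) :+ (v :+ b)) refl (r * x) (s * y) a b ⟩
      (r * x + a) + (s * y + b)   ≈⟨ +-cong ex (sym ey) ⟩
      (s * x + b) + (r * y + a)   ≈⟨ solve 4 (λ u v a b → (u :+ b) :+ (v :+ a) := u :+ v :+ (a :+ b)) refl (s * x) (r * y) a b ⟩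
      s * x + r * y + (a + b)     ∎
    expand : (r - s) * (x - y) ≈ (r * x + s * y) + - (s * x + r * y)
    expand = begin
      (r - s) * (x - y)                                    ≈⟨ [y-z]x≈yx-zx _ _ _ ⟩
      r * (x - y) - s * (x - y)                            ≈⟨ +-cong (x[y-z]≈xy-xz _ _ _) (-‿cong (x[y-z]≈xy-xz _ _ _)) ⟩
      r * x - r * y - (s * x - s * y)                      ≈⟨ +-congˡ (trans (⁻¹-anti-homo-// _ _) (+-comm _ _)) ⟩
      r * x - r * y + (- (s * x) + s * y)                  ≈⟨ solve 4 (λ a b c d → a :+ b :+ (c :+ d) := a :+ d :+ (c :+ b)) refl _ _ _ _ ⟩
      r * x + s * y + (- (s * x) + - (r * y))              ≈⟨ +-congˡ (-‿+-comm _ _) ⟩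
      r * x + s * y + - (s * x + r * y)                    ∎

  -- Such a `G` extends its values at single nodes in the way divided differences do.
  Exchange : (List Carrier → Carrier) → Set _
  Exchange G = ∀ r s rs → r * G (r ∷ s ∷ rs) + G (s ∷ rs) ≈ s * G (r ∷ s ∷ rs) + G (r ∷ rs)

  exchange-0 : Exchange (λ _ → 0#)
  exchange-0 r s rs = +-congʳ (trans (zeroʳ r) (sym (zeroʳ s)))

  -- Divided differences of two functions agreeing at the nodes agree as long as the nodes are distinct.
  exchange-unique : ∀ {G H} → Exchange G → Exchange H → ∀ r rs →
    All (λ s → G [ s ] ≈ H [ s ]) (r ∷ rs) → AllPairs (λ s t → ¬ s ≈ t) (r ∷ rs) → G (r ∷ rs) ≈ H (r ∷ rs)
  exchange-unique exG exH r [] (e ∷ []) _ = e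
  exchange-unique {G} {H} exG exH r (s ∷ rs) (er ∷ es ∷ ers) ((r≉s ∷ r≉) ∷ s≉ ∷ d) =
    exchange-cancel r≉s (exG r s rs) (begin
      r * H (r ∷ s ∷ rs) + G (s ∷ rs) ≈⟨ +-congˡ (exchange-unique {G} {H} exG exH s rs (es ∷ ers) (s≉ ∷ d)) ⟩
      r * H (r ∷ s ∷ rs) + H (s ∷ rs) ≈⟨ exH r s rs ⟩
      s * H (r ∷ s ∷ rs) + H (r ∷ rs) ≈⟨ +-congˡ (exchange-unique {G} {H} exG exH r rs (er ∷ ers) (r≉ ∷ d)) ⟨
      s * H (r ∷ s ∷ rs) + G (r ∷ rs) ∎)

  -- With `B` fixed, `dd K (rs ++ B)` is a divided difference, at the nodes `rs`, of the function
  -- sending s to `dd K (s ∷ B)`. So distinct nodes which may be adjoined to `B` singly may be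
  -- adjoined together.
  dd-vanish : ∀ K B rs → 0 ℕ.< length rs → All (λ s → dd K (s ∷ B) ≈ 0#) rs → AllPairs (λ s t → ¬ s ≈ t) rs →
    dd K (rs ++ B) ≈ 0#
  dd-vanish K B (r ∷ rs) _ =
    exchange-unique {λ rs → dd K (rs ++ B)} {λ _ → 0#} (λ r s rs → dd-exchange K r s (rs ++ B)) exchange-0 r rs

replicate-+ : ∀ {a} {A : Set a} m n (x : A) rs → replicate (m ℕ.+ n) x ++ rs ≡ replicate m x ++ replicate n x ++ rs
replicate-+ zero    n x rs = ≡.refl
replicate-+ (suc m) n x rs = ≡.cong (x ∷_) (replicate-+ m n x rs)

-- Characteristic p and the Frobenius map

CharacteristicDivides : ∀ {c ℓ} → CommutativeRing c ℓ → ℕ → Set (c ⊔ ℓ)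
CharacteristicDivides R p = ∀ x → p ×ₙ x ≈ 0#
  where
  open CommutativeRing R
  open CMult +-commutativeMonoid using () renaming (_×_ to _×ₙ_)

module Frobenius {c ℓ} (R : CommutativeRing c ℓ) (p : ℕ) (p-prime : Prime p) (char : CharacteristicDivides R p) where
  open CommutativeRing R hiding (zero)
  open Exp semiring using (_^_; ^-congʳ; ^-assocʳ)
  open CMult +-commutativeMonoid using (×-homo-+; ×-congˡ) renaming (_×_ to _×ₙ_)
  open Solver commutativeSemiring using (solve; _:+_; _:*_; _:=_)
  open import Relation.Binary.Reasoning.Setoid setoid
  open DividedDifference R

  ×-multiple : ∀ {k x} → k ×ₙ x ≈ 0# → ∀ m → (m ℕ.* k) ×ₙ x ≈ 0#
  ×-multiple kx≈0 zero    = refl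
  ×-multiple {k} {x} kx≈0 (suc m) =
    trans (×-homo-+ x k (m ℕ.* k)) (trans (+-cong kx≈0 (×-multiple kx≈0 m)) (+-identityˡ 0#))

  -- For 0 < k < p a Bézout identity expresses 1 through k and p, and both annihilate `x`. The two
  -- cases are the signs in the identity.
  ×-cancel-0 : ∀ {k x} .{{_ : NonZero k}} → k ℕ.< p → k ×ₙ x ≈ 0# → x ≈ 0#
  ×-cancel-0 {k} {x} k<p kx≈0 with coprime-Bézout (prime⇒coprime p-prime k<p)
  ... | Bézout.+- a b eq = begin
    x                       ≈⟨ +-identityʳ x ⟨
    x + 0#                  ≈⟨ +-congˡ (×-multiple kx≈0 b) ⟨
    (1 ℕ.+ b ℕ.* k) ×ₙ x    ≈⟨ ×-congˡ eq ⟩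
    (a ℕ.* p) ×ₙ x          ≈⟨ ×-multiple (char x) a ⟩
    0#                      ∎
  ... | Bézout.-+ a b eq = begin
    x                       ≈⟨ +-identityʳ x ⟨
    x + 0#                  ≈⟨ +-congˡ (×-multiple (char x) a) ⟨
    (1 ℕ.+ a ℕ.* p) ×ₙ x    ≈⟨ ×-congˡ eq ⟩
    (b ℕ.* k) ×ₙ x          ≈⟨ ×-multiple kx≈0 b ⟩
    0#                      ∎

  sumTo : ℕ → (ℕ → Carrier) → Carrier
  sumTo zero    f = 0#
  sumTo (suc n) f = f 0 + sumTo n (f ∘ suc)

  sumTo-cong : ∀ n {f g} → (∀ i → f i ≈ g i) → sumTo n f ≈ sumTo n g
  sumTo-cong zero    h = refl
  sumTo-cong (suc n) h = +-cong (h 0) (sumTo-cong n (h ∘ suc))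

  sumTo-zero : ∀ n {f} → (∀ i → i ℕ.< n → f i ≈ 0#) → sumTo n f ≈ 0#
  sumTo-zero zero    h = refl
  sumTo-zero (suc n) h = trans (+-cong (h 0 z<s) (sumTo-zero n (λ i i<n → h (suc i) (s<s i<n)))) (+-identityˡ 0#)

  sumTo-first : ∀ n .{{_ : NonZero n}} {f} → (∀ i → suc i ℕ.< n → f (suc i) ≈ 0#) → sumTo n f ≈ f 0
  sumTo-first (suc n) h = trans (+-congˡ (sumTo-zero n λ i i<n → h i (s<s i<n))) (+-identityʳ _)

  sumTo-last : ∀ n f → sumTo (suc n) f ≈ sumTo n f + f n
  sumTo-last zero    f = +-comm _ _
  sumTo-last (suc n) f = trans (+-congˡ (sumTo-last n (f ∘ suc))) (sym (+-assoc _ _ _))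

  sumTo-+ : ∀ n f g → sumTo n (λ i → f i + g i) ≈ sumTo n f + sumTo n g
  sumTo-+ zero    f g = sym (+-identityˡ 0#)
  sumTo-+ (suc n) f g = trans (+-congˡ (sumTo-+ n (f ∘ suc) (g ∘ suc)))
    (solve 4 (λ a b c d → a :+ b :+ (c :+ d) := a :+ c :+ (b :+ d)) refl _ _ _ _)

  module _ (e : ℕ) (β : Carrier) where

    -- The operator E - β on sequences, where E shifts the index by e. For e = 1 and β = b it
    -- deletes the node b from the sequence `dd K (b ∷ rs)`.
    Δ : (ℕ → Carrier) → ℕ → Carrier
    Δ w K = w (K ℕ.+ e) - β * w K

    Δ^ : ℕ → (ℕ → Carrier) → ℕ → Carrier
    Δ^ zero    w = w
    Δ^ (suc i) w = Δ (Δ^ i w)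

    Δ-cong : ∀ {w v} → (∀ K → w K ≈ v K) → ∀ K → Δ w K ≈ Δ v K
    Δ-cong h K = +-cong (h (K ℕ.+ e)) (-‿cong (*-congˡ (h K)))

    Δ^-shift : ∀ i w K → Δ^ i (λ K → w (K ℕ.+ e)) K ≈ Δ^ i w (K ℕ.+ e)
    Δ^-shift zero    w K = refl
    Δ^-shift (suc i) w K = Δ-cong (Δ^-shift i w) K

    Δ-spec : ∀ w K → w (K ℕ.+ e) ≈ Δ w K + β * w K
    Δ-spec w K = begin
      w (K ℕ.+ e)                           ≈⟨ +-identityʳ _ ⟨
      w (K ℕ.+ e) + 0#                      ≈⟨ +-congˡ (-‿inverseˡ _) ⟨
      w (K ℕ.+ e) + (- (β * w K) + β * w K) ≈⟨ +-assoc _ _ _ ⟨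
      Δ w K + β * w K                       ∎

    private
      coeff : ℕ → ℕ → Carrier
      coeff m i = dd m (replicate i β)

    -- Newton's expansion of X^m at the node β repeated, evaluated at the operator w ↦ w (· + e).
    Δ-newton : ∀ m w K N → m ℕ.< N → w (K ℕ.+ m ℕ.* e) ≈ sumTo N (λ i → coeff m (suc i) * Δ^ i w K)
    Δ-newton zero w K (suc N) _ = begin
      w (K ℕ.+ 0)                 ≡⟨ ≡.cong w (ℕₚ.+-identityʳ K) ⟩
      w K                         ≈⟨ +-identityʳ _ ⟨
      w K + 0#                    ≈⟨ +-cong (*-identityˡ _) (sumTo-zero N λ i _ → zeroˡ _) ⟨
      1# * w K + sumTo N (λ i → 0# * Δ^ (suc i) w K) ∎
    Δ-newton (suc m) w K (suc N) (s≤s m<N) = begin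
      w (K ℕ.+ (e ℕ.+ m ℕ.* e))   ≡⟨ ≡.cong w (≡.trans (≡.cong (K ℕ.+_) (ℕₚ.+-comm e _)) (≡.sym (ℕₚ.+-assoc K _ e))) ⟩
      w (K ℕ.+ m ℕ.* e ℕ.+ e)     ≈⟨ Δ-newton m (λ K → w (K ℕ.+ e)) K (suc N) (ℕₚ.m≤n⇒m≤1+n m<N) ⟩
      sumTo (suc N) (λ i → coeff m (suc i) * Δ^ i (λ K → w (K ℕ.+ e)) K)
        ≈⟨ sumTo-cong (suc N) (λ i → trans (*-congˡ (trans (Δ^-shift i w K) (Δ-spec (Δ^ i w) K)))
             (solve 4 (λ a x b y → a :* (x :+ b :* y) := a :* x :+ b :* a :* y) refl (coeff m (suc i)) (Δ^ (suc i) w K) β (Δ^ i w K))) ⟩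
      -- E = Δ + β has split every term in two. The last `up` vanishes by degree, and `up 0` may be
      -- added because `coeff m 0` has no nodes. Then `stay i + up i` is the recursion of `dd` for
      -- `coeff (suc m) (suc i)`.
      sumTo (suc N) (λ i → up (suc i) + stay i)                    ≈⟨ sumTo-+ (suc N) (up ∘ suc) stay ⟩
      sumTo (suc N) (up ∘ suc) + sumTo (suc N) stay
        ≈⟨ +-congʳ (trans (sumTo-last N (up ∘ suc)) (trans (+-congˡ (trans (*-congʳ top) (zeroˡ _))) (+-identityʳ _))) ⟩
      sumTo N (up ∘ suc) + sumTo (suc N) stay
        ≈⟨ +-congʳ (trans (+-congʳ (zeroˡ _)) (+-identityˡ _)) ⟨
      sumTo (suc N) up + sumTo (suc N) stay                        ≈⟨ +-comm _ _ ⟩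
      sumTo (suc N) stay + sumTo (suc N) up                        ≈⟨ sumTo-+ (suc N) stay up ⟨
      sumTo (suc N) (λ i → stay i + up i)
        ≈⟨ sumTo-cong (suc N) (λ i → distribʳ (Δ^ i w K) (β * coeff m (suc i)) (coeff m i)) ⟨
      sumTo (suc N) (λ i → coeff (suc m) (suc i) * Δ^ i w K) ∎
      where
      up stay : ℕ → Carrier
      up   i = coeff m i * Δ^ i w K
      stay i = β * coeff m (suc i) * Δ^ i w K
      top : coeff m (suc N) ≈ 0#
      top = dd-long m (replicate (suc N) β) (≡.subst (suc m ℕ.<_) (≡.sym (length-replicate (suc N))) (s≤s m<N))

    -- The element is the binomial coefficient of p over i times a power of β. As X^p has derivative
    -- 0, the derivative sum at i copies of β consists of i equal terms with sum 0, and i is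
    -- cancelled.
    dd-frobenius-middle : ∀ i → i ℕ.< p → .{{_ : NonZero i}} → coeff p (suc i) ≈ 0#
    dd-frobenius-middle i i<p = ×-cancel-0 i<p (begin
      i ×ₙ coeff p (suc i)                                        ≈⟨ sumOver-replicate (λ r → dd p (r ∷ replicate i β)) i β ⟨
      sumOver (λ r → dd p (r ∷ replicate i β)) (replicate i β)   ≈⟨ dd-derivative-0 p (replicate i β) char ⟩
      0#                                                         ∎)

    -- This is E^p = β^p + (E - β)^p: in Newton's expansion the terms strictly between 0 and p
    -- vanish.
    Δ-frobenius : ∀ w K → w (K ℕ.+ p ℕ.* e) ≈ β ^ p * w K + Δ^ p w K
    Δ-frobenius w K = begin
      w (K ℕ.+ p ℕ.* e)          ≈⟨ Δ-newton p w K (suc p) ℕₚ.≤-refl ⟩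
      sumTo (suc p) term         ≈⟨ sumTo-last p term ⟩
      sumTo p term + term p      ≈⟨ +-cong (sumTo-first p {{prime⇒nonZero p-prime}} λ i i<p → trans (*-congʳ (dd-frobenius-middle (suc i) i<p)) (zeroˡ _))
                                      (trans (*-congʳ (dd-monic p _ (length-replicate (suc p)))) (*-identityˡ _)) ⟩
      term 0 + Δ^ p w K          ≈⟨ +-congʳ (*-congʳ (dd-singleton p β)) ⟩
      β ^ p * w K + Δ^ p w K     ∎
      where
      term : ℕ → Carrier
      term i = coeff p (suc i) * Δ^ i w K

  -- Since (X - b)^P = X^P - b^P for P = p^j, the Leibniz rule defining `dd` holds with X^P for X
  -- and P copies of `b` for one. The step to j + 1 deletes p blocks of p^j copies, one with each
  -- application of `Δ`.
  dd-frobenius : ∀ j b rs K →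
    dd (K ℕ.+ p ℕ.^ j) (replicate (p ℕ.^ j) b ++ rs) ≈ b ^ (p ℕ.^ j) * dd K (replicate (p ℕ.^ j) b ++ rs) + dd K rs
  dd-frobenius zero    b rs K = begin
    dd (K ℕ.+ 1) (b ∷ rs)             ≡⟨ ≡.cong (λ k → dd k (b ∷ rs)) (ℕₚ.+-comm K 1) ⟩
    b * dd K (b ∷ rs) + dd K rs       ≈⟨ +-congʳ (*-congʳ (*-identityʳ b)) ⟨
    b * 1# * dd K (b ∷ rs) + dd K rs  ∎
  dd-frobenius (suc j) b rs K = begin
    w (K ℕ.+ p ℕ.* e)                      ≈⟨ Δ-frobenius e (b ^ e) w K ⟩
    (b ^ e) ^ p * w K + Δ^ e (b ^ e) p w K ≈⟨ +-cong (*-congʳ (trans (^-assocʳ b e p) (^-congʳ b (ℕₚ.*-comm e p)))) (Δ^-replicate p 0 p (≡.sym (ℕₚ.+-identityʳ p)) K) ⟩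
    b ^ (p ℕ.* e) * w K + dd K rs          ∎
    where
    e = p ℕ.^ j
    w : ℕ → Carrier
    w K = dd K (replicate (p ℕ.* e) b ++ rs)
    Δ^-replicate : ∀ i m n → n ≡ i ℕ.+ m → ∀ K →
      Δ^ e (b ^ e) i (λ K → dd K (replicate (n ℕ.* e) b ++ rs)) K ≈ dd K (replicate (m ℕ.* e) b ++ rs)
    Δ^-replicate zero    m n ≡.refl K = refl
    Δ^-replicate (suc i) m n eq K = begin
      Δ e (b ^ e) (Δ^ e (b ^ e) i _) K
        ≈⟨ Δ-cong e (b ^ e) (Δ^-replicate i (suc m) n (≡.trans eq (≡.sym (ℕₚ.+-suc i m)))) K ⟩
      dd (K ℕ.+ e) (replicate (e ℕ.+ m ℕ.* e) b ++ rs) - b ^ e * dd K (replicate (e ℕ.+ m ℕ.* e) b ++ rs)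
        ≡⟨ ≡.cong (λ t → dd (K ℕ.+ e) t - b ^ e * dd K t) (replicate-+ e (m ℕ.* e) b rs) ⟩
      dd (K ℕ.+ e) (replicate e b ++ T) - b ^ e * dd K (replicate e b ++ T)
        ≈⟨ +-congʳ (dd-frobenius j b T K) ⟩
      b ^ e * dd K (replicate e b ++ T) + dd K T - b ^ e * dd K (replicate e b ++ T)
        ≈⟨ trans (+-congʳ (+-comm _ _)) (+-assoc _ _ _) ⟩
      dd K T + (b ^ e * dd K (replicate e b ++ T) - b ^ e * dd K (replicate e b ++ T))
        ≈⟨ trans (+-congˡ (-‿inverseʳ _)) (+-identityʳ _) ⟩
      dd K T ∎
      where T = replicate (m ℕ.* e) b ++ rs

  stretch : ℕ → List Carrier → List Carrier
  stretch P = foldr (λ r rs → replicate P r ++ rs) []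

  -- By `dd-frobenius`, P copies of r obey the recursion of `dd` at the single node r^P. The
  -- recursion ends at the unrepeated node `s`, where both sides are s^(K P).
  dd-stretch : ∀ j s rs K →
    dd (K ℕ.* p ℕ.^ j) (stretch (p ℕ.^ j) rs ++ [ s ]) ≈ dd K (map (_^ (p ℕ.^ j)) rs ++ [ s ^ (p ℕ.^ j) ])
  dd-stretch j s [] K = begin
    dd (K ℕ.* p ℕ.^ j) [ s ]     ≈⟨ dd-singleton (K ℕ.* p ℕ.^ j) s ⟩
    s ^ (K ℕ.* p ℕ.^ j)          ≈⟨ trans (^-assocʳ s (p ℕ.^ j) K) (^-congʳ s (ℕₚ.*-comm (p ℕ.^ j) K)) ⟨
    (s ^ (p ℕ.^ j)) ^ K          ≈⟨ dd-singleton K _ ⟨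
    dd K [ s ^ (p ℕ.^ j) ]       ∎
  -- Both lists have at least two nodes, too many for the exponent 0.
  dd-stretch j s (r ∷ rs) zero = trans
    (dd-long 0 ((replicate P r ++ stretch P rs) ++ [ s ]) (long (p ℕ.^ j) {{ℕₚ.m^n≢0 p j {{prime⇒nonZero p-prime}}}}))
    (sym (dd-long 0 (map (_^ P) (r ∷ rs) ++ [ s ^ P ]) (s≤s (≡.subst (1 ℕ.≤_) (≡.sym (length-++-sucʳ (map (_^ P) rs) (s ^ P) [])) z<s))))
    where
    P = p ℕ.^ j
    long : ∀ P .{{_ : NonZero P}} → 1 ℕ.< length ((replicate P r ++ stretch (p ℕ.^ j) rs) ++ [ s ])
    long (suc P) = s≤s (≡.subst (1 ℕ.≤_) (≡.sym (length-++-sucʳ (replicate P r ++ stretch (p ℕ.^ j) rs) s [])) z<s)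
  dd-stretch j s (r ∷ rs) (suc K) = begin
    dd (P ℕ.+ K ℕ.* P) ((replicate P r ++ stretch P rs) ++ [ s ]) ≡⟨ ≡.cong₂ dd (ℕₚ.+-comm P _) assoc ⟩
    dd (K ℕ.* P ℕ.+ P) (replicate P r ++ T)                      ≈⟨ dd-frobenius j r T (K ℕ.* P) ⟩
    r ^ P * dd (K ℕ.* P) (replicate P r ++ T) + dd (K ℕ.* P) T   ≡⟨ ≡.cong (λ t → r ^ P * dd (K ℕ.* P) t + dd (K ℕ.* P) T) assoc ⟨
    r ^ P * dd (K ℕ.* P) (stretch P (r ∷ rs) ++ [ s ]) + dd (K ℕ.* P) T
      ≈⟨ +-cong (*-congˡ (dd-stretch j s (r ∷ rs) K)) (dd-stretch j s rs K) ⟩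
    dd (suc K) (map (_^ P) (r ∷ rs) ++ [ s ^ P ]) ∎
    where
    P = p ℕ.^ j
    T = stretch P rs ++ [ s ]
    assoc = ++-assoc (replicate P r) (stretch P rs) [ s ]

-- Polynomial functions

module PolynomialFunction {c ℓ} (R : CommutativeRing c ℓ) (*-cancel-0 : NoZeroDivisors R) where
  open CommutativeRing R hiding (zero)
  open Exp semiring using (_^_)
  open Solver commutativeSemiring using (solve; _:+_; _:*_; _:=_)
  open import Relation.Binary.Reasoning.Setoid setoid
  open DividedDifference R
  open Exchange R *-cancel-0 using (exchange-cancel)

  -- f is a polynomial function of degree < e: its difference quotient at any point a is one of degree < e - 1.
  Degree< : ℕ → (Carrier → Carrier) → Set (c ⊔ ℓ)
  Degree< zero    f = ∀ y → f y ≈ 0#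
  Degree< (suc e) f = ∀ a → Σ[ g ∈ (Carrier → Carrier) ] Degree< e g × (∀ y → f y + a * g y ≈ f a + y * g y)

  Degree<-0 : ∀ e {f} → (∀ y → f y ≈ 0#) → Degree< e f
  Degree<-0 zero    f≈0   = f≈0
  Degree<-0 (suc e) f≈0 a = (λ _ → 0#) , Degree<-0 e (λ _ → refl) , λ y →
    +-cong (trans (f≈0 y) (sym (f≈0 a))) (trans (zeroʳ a) (sym (zeroʳ y)))

  Degree<-const : ∀ e b → Degree< (suc e) (λ _ → b)
  Degree<-const e b a = (λ _ → 0#) , Degree<-0 e (λ _ → refl) , λ y → +-congˡ (trans (zeroʳ a) (sym (zeroʳ y)))

  Degree<-cong : ∀ e {f g} → (∀ y → f y ≈ g y) → Degree< e f → Degree< e g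
  Degree<-cong zero    f≈g f≈0   = λ y → trans (sym (f≈g y)) (f≈0 y)
  Degree<-cong (suc e) f≈g df a with df a
  ... | h , dh , eq = h , dh , λ y → trans (+-congʳ (sym (f≈g y))) (trans (eq y) (+-congʳ (f≈g a)))

  Degree<-suc : ∀ e {f} → Degree< e f → Degree< (suc e) f
  Degree<-suc zero    f≈0  = Degree<-0 1 f≈0
  Degree<-suc (suc e) df a with df a
  ... | h , dh , eq = h , Degree<-suc e dh , eq

  Degree<-mono : ∀ {e e′ f} → e ℕ.≤′ e′ → Degree< e f → Degree< e′ f
  Degree<-mono ℕ.≤′-refl     df = df
  Degree<-mono (ℕ.≤′-step l) df = Degree<-suc _ (Degree<-mono l df)

  Degree<-+ : ∀ e {f g} → Degree< e f → Degree< e g → Degree< e (λ y → f y + g y)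
  Degree<-+ zero    f≈0 g≈0 y = trans (+-cong (f≈0 y) (g≈0 y)) (+-identityˡ 0#)
  Degree<-+ (suc e) {f} {g} df dg a with df a | dg a
  ... | f′ , df′ , eqf | g′ , dg′ , eqg = (λ y → f′ y + g′ y) , Degree<-+ e df′ dg′ , λ y → begin
    f y + g y + a * (f′ y + g′ y)         ≈⟨ solve 5 (λ f g a f′ g′ → f :+ g :+ a :* (f′ :+ g′) := (f :+ a :* f′) :+ (g :+ a :* g′)) refl _ _ _ _ _ ⟩
    (f y + a * f′ y) + (g y + a * g′ y)   ≈⟨ +-cong (eqf y) (eqg y) ⟩
    (f a + y * f′ y) + (g a + y * g′ y)   ≈⟨ solve 5 (λ f g a f′ g′ → (f :+ a :* f′) :+ (g :+ a :* g′) := f :+ g :+ a :* (f′ :+ g′)) refl _ _ _ _ _ ⟩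
    f a + g a + y * (f′ y + g′ y)         ∎

  Degree<-scale : ∀ e b {f} → Degree< e f → Degree< e (λ y → b * f y)
  Degree<-scale zero    b f≈0 y = trans (*-congˡ (f≈0 y)) (zeroʳ b)
  Degree<-scale (suc e) b {f} df a with df a
  ... | f′ , df′ , eq = (λ y → b * f′ y) , Degree<-scale e b df′ , λ y → begin
    b * f y + a * (b * f′ y)  ≈⟨ solve 4 (λ b f a f′ → b :* f :+ a :* (b :* f′) := b :* (f :+ a :* f′)) refl _ _ _ _ ⟩
    b * (f y + a * f′ y)      ≈⟨ *-congˡ (eq y) ⟩
    b * (f a + y * f′ y)      ≈⟨ solve 4 (λ b f a f′ → b :* (f :+ a :* f′) := b :* f :+ a :* (b :* f′)) refl _ _ _ _ ⟩
    b * f a + y * (b * f′ y)  ∎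

  Degree<-linear : ∀ e u v {f} → Degree< e f → Degree< (suc e) (λ y → (u + v * y) * f y)
  Degree<-linear zero    u v f≈0 = Degree<-0 1 λ y → trans (*-congˡ (f≈0 y)) (zeroʳ _)
  Degree<-linear (suc e) u v {f} df a with df a
  ... | f′ , df′ , eq = (λ y → (u + v * y) * f′ y + v * f a) ,
    Degree<-+ (suc e) (Degree<-linear e u v df′) (Degree<-const e (v * f a)) , λ y → begin
    (u + v * y) * f y + a * ((u + v * y) * f′ y + v * f a)
      ≈⟨ solve 7 (λ u v y a fy fa f′ → (u :+ v :* y) :* fy :+ a :* ((u :+ v :* y) :* f′ :+ v :* fa)
                 := (u :+ v :* y) :* (fy :+ a :* f′) :+ a :* v :* fa) refl u v y a (f y) (f a) (f′ y) ⟩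
    (u + v * y) * (f y + a * f′ y) + a * v * f a
      ≈⟨ +-congʳ (*-congˡ (eq y)) ⟩
    (u + v * y) * (f a + y * f′ y) + a * v * f a
      ≈⟨ solve 6 (λ u v y a fa f′ → (u :+ v :* y) :* (fa :+ y :* f′) :+ a :* v :* fa
                 := (u :+ v :* a) :* fa :+ y :* ((u :+ v :* y) :* f′ :+ v :* fa)) refl u v y a (f a) (f′ y) ⟩
    (u + v * a) * f a + y * ((u + v * y) * f′ y + v * f a) ∎

  Degree<-power : ∀ m e {f} → Degree< e f → Degree< (m ℕ.+ e) (λ y → y ^ m * f y)
  Degree<-power zero    e df = Degree<-cong e (λ y → sym (*-identityˡ _)) df
  Degree<-power (suc m) e df = Degree<-cong (suc m ℕ.+ e)
    (λ y → trans (*-congʳ (trans (+-identityˡ _) (*-identityˡ y))) (sym (*-assoc y _ _)))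
    (Degree<-linear (m ℕ.+ e) 0# 1# (Degree<-power m e df))

  -- In the application each `v` is minus the m-th power of excluded values of y, so the product
  -- vanishes at all of these.
  binomials : ℕ → List Carrier → Carrier → Carrier
  binomials m vs y = foldr (λ v acc → (y ^ m + v) * acc) 1# vs

  Degree<-binomials : ∀ m vs e {f} → Degree< e f → Degree< (length vs ℕ.* m ℕ.+ e) (λ y → binomials m vs y * f y)
  Degree<-binomials m []       e df = Degree<-cong e (λ y → sym (*-identityˡ _)) df
  Degree<-binomials m (v ∷ vs) e {f} df = ≡.subst (λ n → Degree< n (λ y → binomials m (v ∷ vs) y * f y)) (≡.sym (ℕₚ.+-assoc m (length vs ℕ.* m) e))
    (Degree<-cong (m ℕ.+ e′) (λ y → trans (sym (distribʳ _ _ _)) (sym (*-assoc _ _ _)))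
      (Degree<-+ (m ℕ.+ e′) (Degree<-power m e′ ih) (Degree<-mono (ℕₚ.≤⇒≤′ (ℕₚ.m≤n+m e′ m)) (Degree<-scale e′ v ih))))
    where
    e′ = length vs ℕ.* m ℕ.+ e
    ih = Degree<-binomials m vs e df

  -- A divided difference of X^K at n nodes is the complete homogeneous polynomial of degree K + 1 -
  -- n in them, and the nodes are linear in y.
  Degree<-dd : ∀ {x} {X : Set x} (u v : X → Carrier) K L e → 2 ℕ.+ K ℕ.≤ length L ℕ.+ e →
    Degree< e (λ y → dd K (map (λ l → u l + v l * y) L))
  Degree<-dd u v K       []           e       _ = Degree<-0 e (λ _ → refl)
  Degree<-dd u v zero    (_ ∷ [])     zero    (s≤s ())
  Degree<-dd u v zero    (_ ∷ [])     (suc e) _ = Degree<-const e 1#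
  Degree<-dd u v zero    (_ ∷ _ ∷ _)  e       _ = Degree<-0 e (λ _ → refl)
  Degree<-dd u v (suc K) (l ∷ L)      zero    h =
    λ y → dd-long (suc K) (map _ (l ∷ L)) (≡.subst (3 ℕ.+ K ℕ.≤_) (≡.trans (ℕₚ.+-identityʳ _) (≡.sym (length-map _ (l ∷ L)))) h)
  Degree<-dd u v (suc K) (l ∷ L)      (suc e) h = Degree<-+ (suc e)
    (Degree<-linear e (u l) (v l) (Degree<-dd u v K (l ∷ L) e (s≤s⁻¹ (≡.subst (3 ℕ.+ K ℕ.≤_) (ℕₚ.+-suc _ e) h))))
    (Degree<-dd u v K L (suc e) (s≤s⁻¹ h))

  -- The difference quotient at the first root has smaller degree and vanishes at the other roots,
  -- so it is 0 by induction.
  Degree<-roots : ∀ e {f} → Degree< e f → (pts : Fin e → Carrier) → (∀ {i j} → i ≢ j → ¬ pts i ≈ pts j) →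
    (∀ i → f (pts i) ≈ 0#) → ∀ z → f z ≈ 0#
  Degree<-roots zero    f≈0 _ _ _ = f≈0
  Degree<-roots (suc e) {f} df pts distinct root z with df (pts zero)
  ... | g , dg , eq = begin
    f z                          ≈⟨ +-identityʳ _ ⟨
    f z + 0#                     ≈⟨ +-congˡ (trans (*-congˡ (g≈0 z)) (zeroʳ _)) ⟨
    f z + pts zero * g z         ≈⟨ eq z ⟩
    f (pts zero) + z * g z       ≈⟨ +-cong (root zero) (trans (*-congˡ (g≈0 z)) (zeroʳ z)) ⟩
    0# + 0#                      ≈⟨ +-identityˡ 0# ⟩
    0#                           ∎
    where
    g≈0 : ∀ z → g z ≈ 0#
    g≈0 = Degree<-roots e dg (pts ∘ suc) (λ i≢j → distinct (i≢j ∘ Finₚ.suc-injective)) λ i →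
      exchange-cancel {pts zero} {pts (suc i)} {a = 0#} {b = 0#} (distinct λ ()) (begin
        pts zero * g (pts (suc i)) + 0#                ≈⟨ trans (+-comm _ _) (+-congʳ (sym (root (suc i)))) ⟩
        f (pts (suc i)) + pts zero * g (pts (suc i))   ≈⟨ eq (pts (suc i)) ⟩
        f (pts zero) + pts (suc i) * g (pts (suc i))   ≈⟨ trans (+-congʳ (root zero)) (+-comm _ _) ⟩
        pts (suc i) * g (pts (suc i)) + 0#             ∎)
        (+-congʳ (trans (zeroʳ _) (sym (zeroʳ _))))

-- Finite fields

module FiniteFieldProperties {c ℓ₁ ℓ₂ q′} (F : FiniteField c ℓ₁ ℓ₂ (suc q′)) where
  open FiniteField F using (commutativeRing; size; heytingField)
  open CommutativeRing commutativeRing hiding (zero)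
  open RingProperties ring
  open Exp semiring using (_^_)
  open Mult semiring using (×1-homo-*; ×-assoc-*; ×-congʳ) renaming (_×_ to _×ₙ_)
  open Inverse size using (to; from; to-cong)
  open import Relation.Binary.Reasoning.Setoid setoid
  private
    module H = HeytingField heytingField
    module Π = Sum *-commutativeMonoid
    module Σ = Sum +-commutativeMonoid

  from-to : ∀ x → from (to x) ≈ x
  from-to x = Inverse.inverseʳ size ≡.refl

  to-from : ∀ i → to (from i) ≡ i
  to-from i = Inverse.inverseˡ size refl

  from-injective : ∀ {i j} → from i ≈ from j → i ≡ j
  from-injective {i} {j} eq = ≡.trans (≡.sym (to-from i)) (≡.trans (to-cong eq) (to-from j))

  -- Tightness yields x # 0 only under a double negation. Having an inverse is decidable over a
  -- finite carrier, which removes it.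
  inverse : ∀ {x} → ¬ x ≈ 0# → ∃[ z ] z * x ≈ 1#
  inverse {x} x≉0 = decidable-stable
    (any-dec size (λ u≈v ux≈1 → trans (*-congʳ (sym u≈v)) ux≈1) (λ z → ≈-dec size (z * x) 1#))
    λ ¬inv → x≉0 $ proj₁ (H.tight x 0#) λ x#0 →
      let z , zx≈1 , _ = H.#⇒invertible x#0 in
      ¬inv (z , trans (*-congˡ (sym (trans (+-congˡ -0#≈0#) (+-identityʳ x)))) zx≈1)

  *-cancel-0 : NoZeroDivisors commutativeRing
  *-cancel-0 {x} {y} x≉0 xy≈0 = let z , zx≈1 = inverse x≉0 in begin
    y             ≈⟨ *-identityˡ y ⟨
    1# * y        ≈⟨ *-congʳ zx≈1 ⟨
    z * x * y     ≈⟨ *-assoc z x y ⟩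
    z * (x * y)   ≈⟨ *-congˡ xy≈0 ⟩
    z * 0#        ≈⟨ zeroʳ z ⟩
    0#            ∎

  *-≉0 : ∀ {x y} → ¬ x ≈ 0# → ¬ y ≈ 0# → ¬ x * y ≈ 0#
  *-≉0 x≉0 y≉0 xy≈0 = y≉0 (*-cancel-0 x≉0 xy≈0)

  bijection : (f g : Carrier → Carrier) → (∀ {x y} → x ≈ y → f x ≈ f y) → (∀ {x y} → x ≈ y → g x ≈ g y) →
    (∀ x → f (g x) ≈ x) → (∀ x → g (f x) ≈ x) → Perm.Permutation (suc q′) (suc q′)
  bijection f g f-cong g-cong fg gf = Perm.permutation (to ∘ f ∘ from) (to ∘ g ∘ from)
    (λ i → ≡.trans (to-cong (trans (f-cong (from-to _)) (fg _))) (to-from i))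
    (λ i → ≡.trans (to-cong (trans (g-cong (from-to _)) (gf _))) (to-from i))

  -- Translation by 1 permutes the field, so adding q times 1 does not change the sum of all
  -- elements.
  q×1≈0 : suc q′ ×ₙ 1# ≈ 0#
  q×1≈0 = sym $ +-cancelˡ (Σ.sum from) _ _ $ begin
    Σ.sum from + 0#                                 ≈⟨ +-identityʳ _ ⟩
    Σ.sum from                                      ≈⟨ Σ.sum-permute from π ⟩
    Σ.sum (λ i → from (to (from i + 1#)))           ≈⟨ Σ.sum-cong-≋ (λ i → from-to (from i + 1#)) ⟩
    Σ.sum (λ i → from i + 1#)                       ≈⟨ Σ.∑-distrib-+ from (λ _ → 1#) ⟩
    Σ.sum from + Σ.sum {suc q′} (λ _ → 1#)          ≈⟨ +-congˡ (Σ.sum-replicate (suc q′)) ⟩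
    Σ.sum from + suc q′ ×ₙ 1#                        ∎
    where
    π = bijection (_+ 1#) (_- 1#) +-congʳ +-congʳ
      (λ x → trans (+-assoc x _ _) (trans (+-congˡ (-‿inverseˡ 1#)) (+-identityʳ x)))
      (λ x → trans (+-assoc x _ _) (trans (+-congˡ (-‿inverseʳ 1#)) (+-identityʳ x)))

  module _ (1≤q′ : 1 ℕ.≤ q′) where

    1≉0 : ¬ 1# ≈ 0#
    1≉0 1≈0 = ℕₚ.<⇒≢ 1≤q′ (two q′ from-injective)
      where
      all-equal : ∀ x y → x ≈ y
      all-equal x y = trans (z x) (sym (z y))
        where
        z : ∀ x → x ≈ 0#
        z x = trans (sym (*-identityʳ x)) (trans (*-congˡ 1≈0) (zeroʳ x))
      two : ∀ n {f : Fin (suc n) → Carrier} → (∀ {i j} → f i ≈ f j → i ≡ j) → 0 ≡ n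
      two zero    inj = ≡.refl
      two (suc n) inj with inj {zero} {suc zero} (all-equal _ _)
      ... | ()

    ^-≉0 : ∀ {x} n → ¬ x ≈ 0# → ¬ x ^ n ≈ 0#
    ^-≉0 zero    x≉0 = 1≉0
    ^-≉0 (suc n) x≉0 = *-≉0 x≉0 (^-≉0 n x≉0)

    -- The k-th power of p times 1 is q times 1, which is 0, and a field has no nonzero nilpotents.
    ×-characteristic : ∀ p k → suc q′ ≡ p ℕ.^ k → CharacteristicDivides commutativeRing p
    ×-characteristic p k q≡pᵏ x = begin
      p ×ₙ x          ≈⟨ ×-congʳ p (*-identityˡ x) ⟨
      p ×ₙ (1# * x)   ≈⟨ ×-assoc-* p 1# x ⟨
      p ×ₙ 1# * x     ≈⟨ *-congʳ p×1≈0 ⟩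
      0# * x         ≈⟨ zeroˡ x ⟩
      0#             ∎
      where
      ×1-homo-^ : ∀ k → (p ℕ.^ k) ×ₙ 1# ≈ (p ×ₙ 1#) ^ k
      ×1-homo-^ zero    = +-identityʳ 1#
      ×1-homo-^ (suc k) = trans (×1-homo-* p (p ℕ.^ k)) (*-congˡ (×1-homo-^ k))
      p×1≈0 : p ×ₙ 1# ≈ 0#
      p×1≈0 = decidable-stable (≈-dec size (p ×ₙ 1#) 0#) λ p×1≉0 →
        ^-≉0 k p×1≉0 (trans (sym (×1-homo-^ k)) (trans (reflexive (≡.cong (_×ₙ 1#) (≡.sym q≡pᵏ))) q×1≈0))

    private
      -- The value 1 at 0 lets products over the nonzero elements be indexed by the whole field.
      φ : Carrier → Carrier → Carrier
      φ a x with ≈-dec size x 0#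
      ... | yes _ = 1#
      ... | no  _ = a

      φ-0 : ∀ a {x} → x ≈ 0# → φ a x ≈ 1#
      φ-0 a {x} x≈0 with ≈-dec size x 0#
      ... | yes _   = refl
      ... | no  x≉0 = contradiction x≈0 x≉0

      φ-≉0 : ∀ a {x} → ¬ x ≈ 0# → φ a x ≈ a
      φ-≉0 a {x} x≉0 with ≈-dec size x 0#
      ... | yes x≈0 = contradiction x≈0 x≉0
      ... | no  _   = refl

      Π-≉0 : ∀ n {f : Fin n → Carrier} → (∀ i → ¬ f i ≈ 0#) → ¬ Π.sum f ≈ 0#
      Π-≉0 zero    f≉0 = 1≉0
      Π-≉0 (suc n) f≉0 = *-≉0 (f≉0 zero) (Π-≉0 n (f≉0 ∘ suc))

    -- x ↦ a x permutes the field, so Π x = Π (a x), the products taken over x ≠ 0.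
    fermat-unit : ∀ {a} → ¬ a ≈ 0# → a ^ q′ ≈ 1#
    fermat-unit {a} a≉0 = x∙y⁻¹≈ε⇒x≈y _ _ $ *-cancel-0 ψ≉0 $ begin
      ψ * (a ^ q′ - 1#)          ≈⟨ x[y-z]≈xy-xz _ _ _ ⟩
      ψ * a ^ q′ - ψ * 1#        ≈⟨ x≈y⇒x∙y⁻¹≈ε (trans (*-comm _ _) (trans (sym scaled) (sym (*-identityʳ ψ)))) ⟩
      0#                         ∎
      where
      unit : Fin (suc q′) → Carrier
      unit i = φ (from i) (from i)
      ψ = Π.sum unit
      ψ≉0 : ¬ ψ ≈ 0#
      ψ≉0 = Π-≉0 (suc q′) unit-≉0
        where
        unit-≉0 : ∀ i → ¬ unit i ≈ 0#
        unit-≉0 i with ≈-dec size (from i) 0#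
        ... | yes _   = 1≉0
        ... | no  x≉0 = x≉0
      a⁻¹ = proj₁ (inverse a≉0)
      a⁻¹a≈1 : a⁻¹ * a ≈ 1#
      a⁻¹a≈1 = let _ , eq = inverse a≉0 in eq
      π = bijection (a *_) (a⁻¹ *_) *-congˡ *-congˡ
        (λ x → trans (sym (*-assoc a _ x)) (trans (*-congʳ (trans (*-comm _ _) a⁻¹a≈1)) (*-identityˡ x)))
        (λ x → trans (sym (*-assoc _ a x)) (trans (*-congʳ a⁻¹a≈1) (*-identityˡ x)))
      φ-* : ∀ x y → y ≈ a * x → φ y y ≈ φ a x * φ x x
      φ-* x y y≈ax with ≈-dec size x 0#
      ... | yes x≈0 = trans (φ-0 y (trans y≈ax (trans (*-congˡ x≈0) (zeroʳ a)))) (sym (*-identityˡ 1#))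
      ... | no  x≉0 = trans (φ-≉0 y (λ y≈0 → *-≉0 a≉0 x≉0 (trans (sym y≈ax) y≈0))) y≈ax
      z = to 0#
      factor : Π.sum (λ i → φ a (from i)) ≈ a ^ q′
      factor = begin
        -- Splitting off the index of 0, which contributes 1, leaves q - 1 factors a.
        Π.sum (λ i → φ a (from i))                                    ≈⟨ Π.sum-remove {i = z} (λ i → φ a (from i)) ⟩
        φ a (from z) * Π.sum (λ i → φ a (from (punchIn z i)))         ≈⟨ *-cong (φ-0 a (from-to 0#)) (Π.sum-cong-≋ λ i →
          φ-≉0 a (λ eq → Finₚ.punchInᵢ≢i z i (from-injective (trans eq (sym (from-to 0#)))))) ⟩
        1# * Π.sum {q′} (λ _ → a)                                     ≈⟨ *-identityˡ _ ⟩
        Π.sum {q′} (λ _ → a)                                          ≈⟨ Π.sum-replicate q′ ⟩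
        a ^ q′                                                        ∎
      scaled : ψ ≈ a ^ q′ * ψ
      scaled = begin
        ψ                                            ≈⟨ Π.sum-permute unit π ⟩
        Π.sum (λ i → unit (to (a * from i)))         ≈⟨ Π.sum-cong-≋ (λ i → φ-* (from i) _ (from-to _)) ⟩
        Π.sum (λ i → φ a (from i) * unit i)          ≈⟨ Π.∑-distrib-+ (λ i → φ a (from i)) unit ⟩
        Π.sum (λ i → φ a (from i)) * ψ               ≈⟨ *-congʳ factor ⟩
        a ^ q′ * ψ                                   ∎

    fermat : ∀ a → a ^ suc q′ ≈ a
    fermat a with ≈-dec size a 0#
    ... | yes a≈0 = trans (*-congʳ a≈0) (trans (zeroˡ _) (sym a≈0))
    ... | no  a≉0 = trans (*-congˡ (fermat-unit a≉0)) (*-identityʳ a)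

  nonzero : Fin q′ → Carrier
  nonzero i = from (punchIn (to 0#) i)

  nonzero-≉0 : ∀ i → ¬ nonzero i ≈ 0#
  nonzero-≉0 i eq = Finₚ.punchInᵢ≢i (to 0#) i (from-injective (trans eq (sym (from-to 0#))))

  nonzero-distinct : ∀ {i j} → i ≢ j → ¬ nonzero i ≈ nonzero j
  nonzero-distinct i≢j eq = i≢j (Finₚ.punchIn-injective (to 0#) _ _ (from-injective eq))

-- Grids of differences

length-allFin : ∀ n → length (allFin n) ≡ n
length-allFin n = length-tabulate id

length-cartesianProduct : ∀ {a b} {A : Set a} {B : Set b} (xs : List A) (ys : List B) →
  length (cartesianProduct xs ys) ≡ length xs ℕ.* length ys
length-cartesianProduct []       ys = ≡.refl
length-cartesianProduct (x ∷ xs) ys = ≡.trans (length-++ (map (x ,_) ys))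
  (≡.cong₂ ℕ._+_ (length-map (x ,_) ys) (length-cartesianProduct xs ys))

map-proj₂-cartesianProduct : ∀ {a b c} {A : Set a} {B : Set b} {C : Set c} (f : B → C) (xs : List A) (ys : List B) →
  map (f ∘ proj₂) (cartesianProduct xs ys) ≡ concat (replicate (length xs) (map f ys))
map-proj₂-cartesianProduct f []       ys = ≡.refl
map-proj₂-cartesianProduct f (x ∷ xs) ys = ≡.trans (map-++ (f ∘ proj₂) (map (x ,_) ys) _)
  (≡.cong₂ _++_ (≡.sym (map-∘ ys)) (map-proj₂-cartesianProduct f xs ys))

-- The right-hand side has the form of `stretch`: a factor that the map ignores repeats the nodes.
map-proj₁-cartesianProduct : ∀ {a b c} {A : Set a} {B : Set b} {C : Set c} (f : A → C) (xs : List A) (ys : List B) →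
  map (f ∘ proj₁) (cartesianProduct xs ys) ≡ foldr (λ x zs → replicate (length ys) x ++ zs) [] (map f xs)
map-proj₁-cartesianProduct f []       ys = ≡.refl
map-proj₁-cartesianProduct f (x ∷ xs) ys = ≡.trans (map-++ (f ∘ proj₁) (map (x ,_) ys) _)
  (≡.cong₂ _++_ (≡.trans (≡.sym (map-∘ ys)) (constant ys)) (map-proj₁-cartesianProduct f xs ys))
  where
  constant : ∀ ys → map (λ _ → f x) ys ≡ replicate (length ys) (f x)
  constant []       = ≡.refl
  constant (y ∷ ys) = ≡.cong (f x ∷_) (constant ys)

map-concat-replicate : ∀ {a b} {A : Set a} {B : Set b} (f : A → B) c xs →
  map f (concat (replicate c xs)) ≡ concat (replicate c (map f xs))
map-concat-replicate f zero    xs = ≡.refl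
map-concat-replicate f (suc c) xs = ≡.trans (map-++ f xs _) (≡.cong (map f xs ++_) (map-concat-replicate f c xs))

length-concat-replicate : ∀ {a} {A : Set a} c (xs : List A) → length (concat (replicate c xs)) ≡ c ℕ.* length xs
length-concat-replicate zero    xs = ≡.refl
length-concat-replicate (suc c) xs = ≡.trans (length-++ xs) (≡.cong (length xs ℕ.+_) (length-concat-replicate c xs))

-- Arithmetic of the multiplicity of the nodes

module Multiplicity {n P : ℕ} .{{_ : NonZero P}} (P<n : P ℕ.< n) where
  open import Data.Nat.DivMod using (_/_)
  open ℕₚ.≤-Reasoning
  open ℕSolver.+-*-Solver

  instance
    n≢0 : NonZero n
    n≢0 = ℕ.>-nonZero (ℕₚ.≤-<-trans z≤n P<n)

  -- The largest c with c P < n; one of the n rows of the grid is kept for an extra node.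
  μ : ℕ
  μ = (n ∸ 1) / P

  private
    1+[n∸1]≡n : suc (n ∸ 1) ≡ n
    1+[n∸1]≡n = ℕₚ.m+[n∸m]≡n (ℕ.>-nonZero⁻¹ n)

  μ*P<n : μ ℕ.* P ℕ.< n
  μ*P<n = ≡.subst (μ ℕ.* P ℕ.<_) 1+[n∸1]≡n (s≤s (m/n*n≤m (n ∸ 1) P))

  n∸P≤μ*P : n ∸ P ℕ.≤ μ ℕ.* P
  n∸P≤μ*P = ℕₚ.m≤n+o⇒m∸n≤o n P (begin
    n                               ≡⟨ 1+[n∸1]≡n ⟨
    suc (n ∸ 1)                     ≡⟨ ≡.cong suc (m≡m%n+[m/n]*n (n ∸ 1) P) ⟩
    suc ((n ∸ 1) % P) ℕ.+ μ ℕ.* P   ≤⟨ ℕₚ.+-monoˡ-≤ (μ ℕ.* P) (m%n<n (n ∸ 1) P) ⟩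
    P ℕ.+ μ ℕ.* P                   ∎)

  -- With t = n - P, the product n t is P t + t². Here t² exceeds N, and P t supplies one more.
  N+2≤μ*n*P : ∀ {N} → N ℕ.< (n ∸ P) ℕ.* (n ∸ P) → 2 ℕ.+ N ℕ.≤ μ ℕ.* n ℕ.* P
  N+2≤μ*n*P {N} N<t*t = begin
    1 ℕ.+ suc N                 ≤⟨ ℕₚ.+-mono-≤ (ℕₚ.*-mono-≤ (ℕ.>-nonZero⁻¹ P) (ℕₚ.m<n⇒0<n∸m P<n)) N<t*t ⟩
    P ℕ.* t ℕ.+ t ℕ.* t         ≡⟨ ℕₚ.*-distribʳ-+ t P t ⟨
    (P ℕ.+ t) ℕ.* t             ≡⟨ ≡.cong (ℕ._* t) (ℕₚ.m+[n∸m]≡n (ℕₚ.<⇒≤ P<n)) ⟩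
    n ℕ.* t                     ≤⟨ ℕₚ.*-monoʳ-≤ n n∸P≤μ*P ⟩
    n ℕ.* (μ ℕ.* P)             ≡⟨ solve 3 (λ n μ P → n :* (μ :* P) := μ :* n :* P) ≡.refl n μ P ⟩
    μ ℕ.* n ℕ.* P               ∎
    where t = n ∸ P

  -- The multiplicity is later raised from μ to `Q / n`, which has to go upwards. It does, as μ P <
  -- n and n² ≤ Q P.
  μ≤Q/n : ∀ {Q} → n ℕ.* n ℕ.≤ Q ℕ.* P → μ ℕ.≤ Q / n
  μ≤Q/n {Q} n*n≤QP = ≡.subst (ℕ._≤ Q / n) (m*n/n≡m μ n) (/-monoˡ-≤ n (ℕₚ.*-cancelʳ-≤ (μ ℕ.* n) Q P (begin
    μ ℕ.* n ℕ.* P               ≡⟨ solve 3 (λ n μ P → μ :* n :* P := μ :* P :* n) ≡.refl n μ P ⟩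
    μ ℕ.* P ℕ.* n               ≤⟨ ℕₚ.*-monoˡ-≤ n (ℕₚ.<⇒≤ μ*P<n) ⟩
    n ℕ.* n                     ≤⟨ n*n≤QP ⟩
    Q ℕ.* P                     ∎)))

-- The bound for a set with few quotients of differences

module CliqueBound {c ℓ₁ ℓ₂ q′} (F : FiniteField c ℓ₁ ℓ₂ (suc q′)) where
  open FiniteField F using (commutativeRing; size)
  open CommutativeRing commutativeRing hiding (zero)
  open Exp semiring using (_^_; ^-congˡ; ^-congʳ; ^-assocʳ)
  open FiniteFieldProperties F
  open RingProperties ring
  open DividedDifference commutativeRing
  open Exchange commutativeRing *-cancel-0
  open PolynomialFunction commutativeRing *-cancel-0
  open import Data.Nat.DivMod using (_/_)
  open import Relation.Binary.Reasoning.Setoid setoid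

  -- `slope` makes every quotient of differences of `A` a root of `binomials m vs`, `vs-≉0` keeps 0
  -- from being one, and `N<q′` keeps the degree N below the number of nonzero elements.
  module Grid
    {n} (A : Fin n → Carrier) (A-distinct : ∀ {i j} → i ≢ j → ¬ A i ≈ A j)
    (m : ℕ) .{{_ : NonZero m}} (vs : List Carrier) (vs-≉0 : All (λ v → ¬ v ≈ 0#) vs)
    (slope : ∀ {i j k l} → i ≢ j → k ≢ l → ∀ y → A k - A l ≈ y * (A i - A j) → Any (λ v → y ^ m + v ≈ 0#) vs)
    (N<q′ : length vs ℕ.* m ℕ.< q′) where

    N = length vs ℕ.* m
    q = suc q′

    1≤q′ : 1 ℕ.≤ q′
    1≤q′ = ℕₚ.≤-trans (s≤s z≤n) N<q′

    0^n≈0 : ∀ n .{{_ : NonZero n}} → 0# ^ n ≈ 0#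
    0^n≈0 (suc n) = zeroˡ _

    binomials-0 : ∀ {vs} → All (λ v → ¬ v ≈ 0#) vs → ¬ binomials m vs 0# ≈ 0#
    binomials-0 []          = 1≉0 1≤q′
    binomials-0 (v≉0 ∷ vs≉0) = *-≉0 (λ eq → v≉0 (trans (sym (trans (+-congʳ (0^n≈0 m)) (+-identityˡ _))) eq)) (binomials-0 vs≉0)

    binomials-root : ∀ {vs y} → Any (λ v → y ^ m + v ≈ 0#) vs → binomials m vs y ≈ 0#
    binomials-root (here eq)  = trans (*-congʳ eq) (zeroˡ _)
    binomials-root (there as) = trans (*-congˡ (binomials-root as)) (zeroʳ _)

    point : Carrier → Fin n × Fin n → Carrier
    point y (j , k) = A k + A j * y

    -- Equal points with both indices different exhibit y as a quotient of differences, which `good`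
    -- excludes. If one index agrees, distinctness of `A` and y ≠ 0 suffice.
    point-injective : ∀ {y} → ¬ y ≈ 0# → ¬ Any (λ v → y ^ m + v ≈ 0#) vs → ∀ {l l′} → l ≢ l′ → ¬ point y l ≈ point y l′
    point-injective {y} y≉0 good {j , k} {j′ , k′} l≢l′ eq with j ≟ j′ | k ≟ k′
    ... | yes ≡.refl | yes ≡.refl = l≢l′ ≡.refl
    ... | yes ≡.refl | no  k≢k′   = A-distinct k≢k′ (+-cancelʳ _ _ _ eq)
    ... | no  j≢j′   | yes ≡.refl = A-distinct j≢j′ $ x∙y⁻¹≈ε⇒x≈y _ _ $ *-cancel-0 y≉0 $ begin
      y * (A j - A j′)       ≈⟨ trans (*-comm _ _) ([y-z]x≈yx-zx _ _ _) ⟩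
      A j * y - A j′ * y     ≈⟨ x≈y⇒x∙y⁻¹≈ε (+-cancelˡ _ _ _ eq) ⟩
      0#                     ∎
    ... | no  j≢j′   | no  k≢k′   = good $ slope (j≢j′ ∘ ≡.sym) k≢k′ y $ begin
      A k - A k′                                 ≈⟨ +-cong (trans (+-congˡ (-‿inverseʳ _)) (+-identityʳ _)) refl ⟨
      A k + (A j * y - A j * y) - A k′           ≈⟨ +-congʳ (sym (+-assoc _ _ _)) ⟩
      A k + A j * y - A j * y - A k′             ≈⟨ +-congʳ (+-congʳ eq) ⟩
      A k′ + A j′ * y - A j * y - A k′           ≈⟨ +-congʳ (+-assoc _ _ _) ⟩
      A k′ + (A j′ * y - A j * y) - A k′         ≈⟨ xyx⁻¹≈y _ _ ⟩
      A j′ * y - A j * y                         ≈⟨ trans (*-comm _ _) ([y-z]x≈yx-zx _ _ _) ⟨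
      y * (A j′ - A j)                           ∎

    -- On the field X^q agrees with X, whose divided differences at three or more nodes are 0.
    dd-distinct : ∀ rs → AllPairs (λ s t → ¬ s ≈ t) rs → 3 ℕ.≤ length rs → dd q rs ≈ 0#
    dd-distinct (r ∷ rs) distinct 3≤ = begin
      dd q (r ∷ rs)   ≈⟨ exchange-unique {dd q} {dd 1} (dd-exchange q) (dd-exchange 1) r rs
                           (All.universal (λ s → trans (dd-singleton q s) (trans (fermat 1≤q′ s) (sym (trans (dd-singleton 1 s) (*-identityʳ s))))) (r ∷ rs)) distinct ⟩
      dd 1 (r ∷ rs)   ≈⟨ dd-long 1 (r ∷ rs) 3≤ ⟩
      0#              ∎

    -- As a function of y, the divided difference of X^q at the points A k + A j y has degree at most q + 1 - |L|.
    -- It vanishes when y is not a slope determined by the grid, and the binomials vanish at the other y ≠ 0.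
    grid-vanish : ∀ L → Unique L → 3 ℕ.+ N ℕ.≤ length L → dd q (map (A ∘ proj₂) L) ≈ 0#
    grid-vanish L L! N+3≤ = begin
      dd q (map (A ∘ proj₂) L)   ≈⟨ dd-map-cong (λ l → sym (trans (+-congˡ (zeroʳ _)) (+-identityʳ _))) q L ⟩
      -- The product vanishes at the q - 1 nonzero values of y and has degree below q - 1, so it
      -- vanishes at 0, where the binomials do not.
      dd q (map (point 0#) L)    ≈⟨ *-cancel-0 (binomials-0 vs-≉0) (Degree<-roots q′ degree nonzero nonzero-distinct (λ i → root (nonzero-≉0 i)) 0#) ⟩
      0#                         ∎
      where
      -- The divided difference has degree below e; N + 3 nodes are what brings N + e down to q - 1.
      e = 2 ℕ.+ q ∸ length L
      e-bound : N ℕ.+ e ℕ.≤ q′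
      e-bound = ℕₚ.≤-trans (ℕₚ.+-monoʳ-≤ N (ℕₚ.∸-monoʳ-≤ (2 ℕ.+ q) N+3≤)) (ℕₚ.≤-reflexive (ℕₚ.m+[n∸m]≡n (ℕₚ.<⇒≤ N<q′)))
      degree : Degree< q′ (λ y → binomials m vs y * dd q (map (point y) L))
      degree = Degree<-mono (ℕₚ.≤⇒≤′ e-bound) (Degree<-binomials m vs e
        (Degree<-dd (A ∘ proj₂) (A ∘ proj₁) q L e (ℕₚ.m≤n+m∸n (2 ℕ.+ q) (length L))))
      root : ∀ {y} → ¬ y ≈ 0# → binomials m vs y * dd q (map (point y) L) ≈ 0#
      root {y} y≉0 with Any.any? (λ v → ≈-dec size (y ^ m + v) 0#) vs
      ... | yes bad  = trans (*-congʳ (binomials-root bad)) (zeroˡ _)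
      ... | no  good = trans (*-congˡ (dd-distinct (map (point y) L)
        (AllPairsₚ.map⁺ (AllPairs.map (point-injective y≉0 good) L!))
        (≡.subst (3 ℕ.≤_) (≡.sym (length-map (point y) L)) (ℕₚ.≤-trans (ℕₚ.m≤m+n 3 N) N+3≤)))) (zeroʳ _)

    -- At q + 1 positions of the grid the divided difference of X^q would be 1 as a leading
    -- coefficient and 0 by `grid-vanish`.
    n*n≤q : n ℕ.* n ℕ.≤ q
    n*n≤q = ℕₚ.≮⇒≥ λ q<n*n → let
        grid = cartesianProduct (allFin n) (allFin n)
        |grid| = ≡.trans (length-cartesianProduct (allFin n) (allFin n)) (≡.cong₂ ℕ._*_ (length-allFin n) (length-allFin n))
        L = take (suc q) grid
        |L| = ≡.trans (length-take (suc q) grid) (ℕₚ.m≤n⇒m⊓n≡m (≡.subst (suc q ℕ.≤_) (≡.sym |grid|) q<n*n))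
      in 1≉0 1≤q′ (trans
        (sym (dd-monic q (map (A ∘ proj₂) L) (≡.trans (length-map (A ∘ proj₂) L) |L|)))
        (grid-vanish L (Uniqueₚ.take⁺ (suc q) (Uniqueₚ.cartesianProduct⁺ (Uniqueₚ.allFin⁺ n) (Uniqueₚ.allFin⁺ n)))
          (≡.subst (3 ℕ.+ N ℕ.≤_) (≡.sym |L|) (s≤s (s≤s N<q′)))))

    module _ (p r : ℕ) (p-prime : Prime p) (q≡ : q ≡ p ℕ.^ (2 ℕ.* r ℕ.+ 1)) where
      private
        instance
          p≢0 : NonZero p
          p≢0 = prime⇒nonZero p-prime
        P Q : ℕ
        P = p ℕ.^ r
        Q = p ℕ.* P
        instance
          P≢0 : NonZero P
          P≢0 = ℕₚ.m^n≢0 p r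

        q≡Q*P : q ≡ Q ℕ.* P
        q≡Q*P = ≡.trans q≡ $ ≡.trans (≡.cong (p ℕ.^_) (solve 1 (λ r → con 2 :* r :+ con 1 := con 1 :+ r :+ r) ≡.refl r)) (ℕₚ.^-distribˡ-+-* p (suc r) r)
          where open ℕSolver.+-*-Solver

      open CMult +-commutativeMonoid using () renaming (_×_ to _×ₙ_)

      char : CharacteristicDivides commutativeRing p
      char = ×-characteristic 1≤q′ p (2 ℕ.* r ℕ.+ 1) q≡

      open Frobenius commutativeRing p p-prime char

      β : Fin n → Carrier
      β k = A k ^ P

      βs : List Carrier
      βs = tabulate β

      copies : ℕ → List Carrier
      copies c = concat (replicate c βs)

      -- The Q-th power undoes the P-th, since x^(P Q) = x^q = x.
      frobenius-injective : ∀ {x y} → x ^ P ≈ y ^ P → x ≈ y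
      frobenius-injective {x} {y} eq = trans (sym (fermat′ x)) (trans (^-congˡ Q eq) (fermat′ y))
        where
        fermat′ : ∀ x → (x ^ P) ^ Q ≈ x
        fermat′ x = trans (^-assocʳ x P Q) (trans (^-congʳ x (≡.trans (ℕₚ.*-comm P Q) (≡.sym q≡Q*P))) (fermat 1≤q′ x))

      β-distinct : ∀ {i j} → i ≢ j → ¬ β i ≈ β j
      β-distinct i≢j = A-distinct i≢j ∘ frobenius-injective

      -- The one node beyond the c full layers is what `dd-vanish` needs to adjoin any nonempty set
      -- of distinct β.
      Vanish : ℕ → Set _
      Vanish c = ∀ k → dd Q (β k ∷ copies c) ≈ 0#

      -- The rows suc (combine i u) give every β multiplicity c P, and row zero one more A k.
      vanish-start : ∀ c → c ℕ.* P ℕ.< n → 2 ℕ.+ N ℕ.≤ c ℕ.* n ℕ.* P → Vanish c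
      vanish-start c cP<n large k = begin
        dd Q (β k ∷ copies c)                                ≡⟨ ≡.cong (dd Q) (++-identityʳ (β k ∷ copies c)) ⟨
        dd Q (β k ∷ copies c ++ [])                          ≈⟨ dd-shift Q (β k) (copies c) [] ⟨
        dd Q (copies c ++ [ β k ])                           ≡⟨ ≡.cong (λ t → dd Q (t ++ [ β k ])) powers-eq ⟨
        dd Q (map (_^ P) (concat (replicate c (tabulate A))) ++ [ β k ])
                                                             ≈⟨ dd-stretch r (A k) (concat (replicate c (tabulate A))) Q ⟨
        dd (Q ℕ.* P) (stretch P (concat (replicate c (tabulate A))) ++ [ A k ])
                                                             ≡⟨ ≡.cong (λ x → dd x (stretch P (concat (replicate c (tabulate A))) ++ [ A k ])) q≡Q*P ⟨
        dd q (stretch P (concat (replicate c (tabulate A))) ++ [ A k ])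
                                                             ≈⟨ dd-shift q (A k) _ [] ⟩
        dd q (A k ∷ stretch P (concat (replicate c (tabulate A))) ++ [])
                                                             ≡⟨ ≡.cong (dd q) (≡.trans (++-identityʳ _) (≡.cong (A k ∷_) (≡.sym cells-eq))) ⟩
        -- The extra node supplies the last of the N + 3 positions.
        dd q (map (A ∘ proj₂) L)                             ≈⟨ grid-vanish L L! (≡.subst (3 ℕ.+ N ℕ.≤_) (≡.sym |L|) (s≤s large)) ⟩
        0#                                                   ∎
        where
        powers-eq : map (_^ P) (concat (replicate c (tabulate A))) ≡ copies c
        powers-eq = ≡.trans (map-concat-replicate (_^ P) c (tabulate A)) (≡.cong (concat ∘ replicate c) (map-tabulate A (_^ P)))
        Index = (Fin c × Fin n) × Fin P
        pairs : List (Fin c × Fin n)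
        pairs = cartesianProduct (allFin c) (allFin n)
        triples : List Index
        triples = cartesianProduct pairs (allFin P)
        cell : Index → Fin n × Fin n
        cell ((i , j) , u) = inject≤ (suc (combine i u)) cP<n , j
        L : List (Fin n × Fin n)
        L = (inject≤ zero cP<n , k) ∷ map cell triples
        cell-injective : ∀ {x y} → cell x ≡ cell y → x ≡ y
        cell-injective {(i , j) , u} {(i′ , j′) , u′} eq
          with Finₚ.combine-injective i u i′ u′ (Finₚ.suc-injective (Finₚ.inject≤-injective cP<n cP<n _ _ (≡.cong proj₁ eq))) | ≡.cong proj₂ eq
        ... | ≡.refl , ≡.refl | ≡.refl = ≡.refl
        L! : Unique L
        L! = Allₚ.map⁺ (All.universal (λ x eq → Finₚ.0≢1+n (Finₚ.inject≤-injective cP<n cP<n _ _ (≡.cong proj₁ eq))) triples)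
           ∷ Uniqueₚ.map⁺ cell-injective (Uniqueₚ.cartesianProduct⁺ (Uniqueₚ.cartesianProduct⁺ (Uniqueₚ.allFin⁺ c) (Uniqueₚ.allFin⁺ n)) (Uniqueₚ.allFin⁺ P))
        |L| : length L ≡ suc (c ℕ.* n ℕ.* P)
        |L| = ≡.cong suc (≡.trans (length-map cell triples) (≡.trans (length-cartesianProduct pairs (allFin P))
          (≡.cong₂ ℕ._*_ (≡.trans (length-cartesianProduct (allFin c) (allFin n)) (≡.cong₂ ℕ._*_ (length-allFin c) (length-allFin n))) (length-allFin P))))
        cells-eq : map (A ∘ proj₂) (map cell triples) ≡ stretch P (concat (replicate c (tabulate A)))
        cells-eq = ≡.trans (≡.sym (map-∘ triples)) (≡.trans (map-proj₁-cartesianProduct (A ∘ proj₂) pairs (allFin P))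
          (≡.cong₂ stretch (length-allFin P) (≡.trans (map-proj₂-cartesianProduct A (allFin c) (allFin n))
            (≡.cong₂ (λ l t → concat (replicate l t)) (length-allFin c) (map-tabulate id A)))))

      sumOver-single : ∀ {n} (γ : Fin n → Carrier) {f} k → (∀ j → j ≢ k → f (γ j) ≈ 0#) → sumOver f (tabulate γ) ≈ f (γ k)
      sumOver-single γ zero    h = trans (+-congˡ (sumOver-zero _ (Allₚ.tabulate⁺ (λ j → h (suc j) λ ())))) (+-identityʳ _)
      sumOver-single γ (suc k) h = trans (+-cong (h zero λ ()) (sumOver-single (γ ∘ suc) k (λ j j≢k → h (suc j) (j≢k ∘ Finₚ.suc-injective)))) (+-identityˡ _)

      Q×≈0 : ∀ x → Q ×ₙ x ≈ 0#
      Q×≈0 x = trans (reflexive (≡.cong (_×ₙ x) (ℕₚ.*-comm p P))) (×-multiple (char x) P)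

      -- The derivative of X^Q is 0, so its divided difference with β k doubled vanishes too.
      vanish-step : ∀ c → suc c ℕ.< p → Vanish c → Vanish (suc c)
      vanish-step c 1+c<p vanish k = begin
        dd Q (β k ∷ βs ++ copies c)    ≈⟨ dd-shift Q (β k) βs (copies c) ⟨
        dd Q (βs ++ β k ∷ copies c)    ≈⟨ dd-vanish Q (β k ∷ copies c) βs 0<|βs| (Allₚ.tabulate⁺ h-0) (AllPairsₚ.tabulate⁺ β-distinct) ⟩
        0#                             ∎
        where
        h : Carrier → Carrier
        h x = dd Q (x ∷ β k ∷ copies c)
        -- Two distinct extra nodes follow from multiplicity c alone; the derivative is for the
        -- doubled node.
        h-≢ : ∀ j → j ≢ k → h (β j) ≈ 0#
        h-≢ j j≢k = dd-vanish Q (copies c) (β j ∷ [ β k ]) z<s (vanish j ∷ vanish k ∷ []) ((β-distinct j≢k ∷ []) ∷ [] ∷ [])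
        sum-copies : ∀ c → sumOver h (copies c) ≈ c ×ₙ h (β k)
        sum-copies zero    = refl
        sum-copies (suc c) = trans (sumOver-++ h βs (copies c)) (+-cong (sumOver-single β {h} k h-≢) (sum-copies c))
        h-≡ : h (β k) ≈ 0#
        -- In the derivative sum the terms at other nodes vanish, so c + 1 equal terms at `β k` have
        -- sum 0, and c + 1 < p can be cancelled.
        h-≡ = ×-cancel-0 1+c<p (begin
          suc c ×ₙ h (β k)                 ≈⟨ +-congˡ (sum-copies c) ⟨
          sumOver h (β k ∷ copies c)       ≈⟨ dd-derivative-0 Q (β k ∷ copies c) Q×≈0 ⟩
          0#                               ∎)
        h-0 : ∀ j → h (β j) ≈ 0#
        h-0 j with j ≟ k
        ... | yes ≡.refl = h-≡
        ... | no  j≢k    = h-≢ j j≢k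
        0<|βs| : 0 ℕ.< length βs
        0<|βs| = ≡.subst (0 ℕ.<_) (≡.sym (length-tabulate β)) (ℕₚ.≤-<-trans z≤n (Finₚ.toℕ<n k))

      vanish-upward : ∀ {c c′} → c ℕ.≤′ c′ → c′ ℕ.< p → Vanish c → Vanish c′
      vanish-upward ℕ.≤′-refl     c′<p v = v
      vanish-upward (ℕ.≤′-step l) c′<p v = vanish-step _ c′<p (vanish-upward l (ℕₚ.<-trans (ℕₚ.n<1+n _) c′<p) v)

      -- A divided difference of X^Q at Q + 1 nodes is 1.
      ¬vanish : ∀ c t → c ℕ.* n ℕ.+ t ≡ Q → t ℕ.< n → ¬ Vanish c
      -- As t < n there are t + 1 distinct β to adjoin, which brings the c n nodes to Q + 1.
      ¬vanish c t eq t<n vanish = 1≉0 1≤q′ (trans (sym (dd-monic Q (take (suc t) βs ++ copies c) size-eq)) zero-eq)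
        where
        |take| : length (take (suc t) βs) ≡ suc t
        |take| = ≡.trans (length-take (suc t) βs) (ℕₚ.m≤n⇒m⊓n≡m (≡.subst (suc t ℕ.≤_) (≡.sym (length-tabulate β)) t<n))
        size-eq : length (take (suc t) βs ++ copies c) ≡ suc Q
        size-eq = ≡.trans (length-++ (take (suc t) βs)) (≡.trans
          (≡.cong₂ ℕ._+_ |take| (≡.trans (length-concat-replicate c βs) (≡.cong (c ℕ.*_) (length-tabulate β))))
          (≡.cong suc (≡.trans (ℕₚ.+-comm t _) eq)))
        zero-eq : dd Q (take (suc t) βs ++ copies c) ≈ 0#
        zero-eq = dd-vanish Q (copies c) (take (suc t) βs) (≡.subst (0 ℕ.<_) (≡.sym |take|) z<s)
          (Allₚ.take⁺ (suc t) (Allₚ.tabulate⁺ vanish)) (AllPairsₚ.take⁺ (suc t) (AllPairsₚ.tabulate⁺ β-distinct))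

      -- Truncated subtraction lets one inequality cover both outcomes, n ≤ P and (n - P)² ≤ N.
      clique-bound : (n ∸ P) ℕ.* (n ∸ P) ℕ.≤ N
      clique-bound with ℕₚ.≤-<-connex n P
      ... | inj₁ n≤P = ≡.subst (λ t → t ℕ.* t ℕ.≤ N) (≡.sym (ℕₚ.m≤n⇒m∸n≡0 n≤P)) z≤n
      ... | inj₂ P<n = ℕₚ.≮⇒≥ λ N<t*t →
        -- Q nodes form `Q / n` full layers and a remainder. Q = p P < p n gives `Q / n` < p, so the
        -- multiplicity can be raised that far.
        ¬vanish (Q / n) (Q % n) (≡.trans (ℕₚ.+-comm _ (Q % n)) (≡.sym (m≡m%n+[m/n]*n Q n))) (m%n<n Q n)
          (vanish-upward (ℕₚ.≤⇒≤′ (μ≤Q/n (ℕₚ.≤-trans n*n≤q (ℕₚ.≤-reflexive q≡Q*P)))) (m<n*o⇒m/o<n (ℕₚ.*-monoʳ-< p P<n))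
            (vanish-start μ μ*P<n (N+2≤μ*n*P N<t*t)))
        where open Multiplicity P<n

-- Bounds by square roots

fromℚᵘ-mono-≤ : ∀ x y → x ℚᵘ.≤ y → ℚ.fromℚᵘ x ℚ.≤ ℚ.fromℚᵘ y
fromℚᵘ-mono-≤ x y x≤y = ℚₚ.toℚᵘ-cancel-≤ (ℚᵘₚ.≤-respʳ-≃ (ℚᵘₚ.≃-sym (ℚₚ.toℚᵘ-fromℚᵘ y)) (ℚᵘₚ.≤-respˡ-≃ (ℚᵘₚ.≃-sym (ℚₚ.toℚᵘ-fromℚᵘ x)) x≤y))

ι : ℕ → ℚ
ι n = (+ n) ℚ./ 1

ι-mono-≤ : ∀ {a b} → a ℕ.≤ b → ι a ℚ.≤ ι b
ι-mono-≤ {a} {b} a≤b = fromℚᵘ-mono-≤ (mkℚᵘ (+ a) 0) (mkℚᵘ (+ b) 0) (*≤* (ℤₚ.*-monoʳ-≤-nonNeg (+ 1) (+≤+ a≤b)))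

ι-homo-+ : ∀ a b → ι (a ℕ.+ b) ≡ ι a ℚ.+ ι b
ι-homo-+ a b = ℚₚ.toℚᵘ-injective (begin
  ℚ.toℚᵘ (ι (a ℕ.+ b))                   ≈⟨ ℚₚ.toℚᵘ-fromℚᵘ (mkℚᵘ (+ (a ℕ.+ b)) 0) ⟩
  mkℚᵘ (+ (a ℕ.+ b)) 0                   ≈⟨ *≡* (solve 2 (λ a b → (a :+ b) :* con (+ 1) := (a :* con (+ 1) :+ b :* con (+ 1)) :* con (+ 1)) ≡.refl (+ a) (+ b)) ⟩
  mkℚᵘ (+ a) 0 ℚᵘ.+ mkℚᵘ (+ b) 0         ≈⟨ ℚᵘₚ.+-cong (ℚₚ.toℚᵘ-fromℚᵘ (mkℚᵘ (+ a) 0)) (ℚₚ.toℚᵘ-fromℚᵘ (mkℚᵘ (+ b) 0)) ⟨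
  ℚ.toℚᵘ (ι a) ℚᵘ.+ ℚ.toℚᵘ (ι b)         ≈⟨ ℚₚ.toℚᵘ-homo-+ (ι a) (ι b) ⟨
  ℚ.toℚᵘ (ι a ℚ.+ ι b)                   ∎)
  where
  open ℚᵘₚ.≃-Reasoning
  open ℤSolver.+-*-Solver

ι-homo-* : ∀ a b → ι (a ℕ.* b) ≡ ι a ℚ.* ι b
ι-homo-* a b = ℚₚ.toℚᵘ-injective (begin
  ℚ.toℚᵘ (ι (a ℕ.* b))                   ≈⟨ ℚₚ.toℚᵘ-fromℚᵘ (mkℚᵘ (+ (a ℕ.* b)) 0) ⟩
  mkℚᵘ (+ (a ℕ.* b)) 0                   ≈⟨ *≡* (≡.cong (ℤ._* + 1) (ℤₚ.pos-* a b)) ⟩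
  mkℚᵘ (+ a) 0 ℚᵘ.* mkℚᵘ (+ b) 0         ≈⟨ ℚᵘₚ.*-cong (ℚₚ.toℚᵘ-fromℚᵘ (mkℚᵘ (+ a) 0)) (ℚₚ.toℚᵘ-fromℚᵘ (mkℚᵘ (+ b) 0)) ⟨
  ℚ.toℚᵘ (ι a) ℚᵘ.* ℚ.toℚᵘ (ι b)         ≈⟨ ℚₚ.toℚᵘ-homo-* (ι a) (ι b) ⟨
  ℚ.toℚᵘ (ι a ℚ.* ι b)                   ∎)
  where
  open ℚᵘₚ.≃-Reasoning

ι-≤-/ : ∀ x d S .{{_ : NonZero d}} → x ℕ.* d ℕ.≤ S → ι x ℚ.≤ (+ S) ℚ./ d
ι-≤-/ x (suc d) S xd≤S = fromℚᵘ-mono-≤ (mkℚᵘ (+ x) 0) (mkℚᵘ (+ S) d) (*≤* (begin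
  + x ℤ.* + suc d   ≡⟨ ℤₚ.pos-* x (suc d) ⟨
  + (x ℕ.* suc d)   ≤⟨ +≤+ xd≤S ⟩
  + S               ≡⟨ ℤₚ.*-identityʳ (+ S) ⟨
  + S ℤ.* + 1       ∎))
  where open ℤₚ.≤-Reasoning

-- Otherwise 0 ≤ s ≤ a, and then s² ≤ a² ≤ S / d < s².
√-lower : ∀ a d S {s} .{{_ : NonZero d}} → a ℕ.* a ℕ.* d ℕ.≤ S → √ ((+ S) ℚ./ d) s → ι a ℚ.< s
√-lower a d S {s} aad≤S (0≤s , S/d<s²) = ℚₚ.≰⇒> λ s≤a → ℚₚ.<-irrefl ≡.refl (begin-strict
  (+ S) ℚ./ d      <⟨ S/d<s² ⟩
  s ℚ.* s          ≤⟨ ℚₚ.*-monoˡ-≤-nonNeg s {{ℚ.nonNegative 0≤s}} s≤a ⟩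
  s ℚ.* ι a        ≤⟨ ℚₚ.*-monoʳ-≤-nonNeg (ι a) {{ℚ.nonNegative (ℚₚ.≤-trans 0≤s s≤a)}} s≤a ⟩
  ι a ℚ.* ι a      ≡⟨ ι-homo-* a a ⟨
  ι (a ℕ.* a)      ≤⟨ ι-≤-/ (a ℕ.* a) d S aad≤S ⟩
  (+ S) ℚ./ d      ∎)
  where open ℚₚ.≤-Reasoning

-- In terms of upper cuts, n has to lie below every u + v with u and v above the two roots; a < u
-- and b < v give this.
√-+-lower : ∀ {n a b d S p q} .{{_ : NonZero d}} .{{_ : NonZero p}} → n ℕ.≤ a ℕ.+ b →
  a ℕ.* a ℕ.* d ℕ.≤ S → b ℕ.* b ℕ.* p ℕ.≤ q → ⌜ n ⌝ ≤ᵘ √ ((+ S) ℚ./ d) +ᵘ √ ((+ q) ℚ./ p)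
√-+-lower {n} {a} {b} {d} {S} {p} {q} n≤a+b hd hp (u , v , √u , √v , ≡.refl) = begin-strict
  ι n             ≤⟨ ι-mono-≤ n≤a+b ⟩
  ι (a ℕ.+ b)     ≡⟨ ι-homo-+ a b ⟩
  ι a ℚ.+ ι b     <⟨ ℚₚ.+-mono-< (√-lower a d S hd √u) (√-lower b p q hp √v) ⟩
  u ℚ.+ v         ∎
  where open ℚₚ.≤-Reasoning

-- Cayley graphs

members : ∀ {n} → Subset n → List (Fin n)
members []          = []
members (true ∷ s)  = zero ∷ map suc (members s)
members (false ∷ s) = map suc (members s)

length-members : ∀ {n} (s : Subset n) → length (members s) ≡ ∣ s ∣
length-members []          = ≡.refl
length-members (true ∷ s)  = ≡.cong suc (≡.trans (length-map suc (members s)) (length-members s))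
length-members (false ∷ s) = ≡.trans (length-map suc (members s)) (length-members s)

∈-members : ∀ {n} {i : Fin n} {s} → i ∈ s → i ∈ₗ members s
∈-members {s = true ∷ s}  here        = here ≡.refl
∈-members {s = true ∷ s}  (there i∈s) = there (∈-map⁺ suc (∈-members i∈s))
∈-members {s = false ∷ s} (there i∈s) = ∈-map⁺ suc (∈-members i∈s)

∈-differences : ∀ {d} .{{_ : NonZero d}} {I : Subset d} {i j} → i ∈ I → j ∈ I → (i ⊖ j) ∈ differences I
∈-differences {I = I} {i} {j} i∈I j∈I = lookup⇒[]= (i ⊖ j) (differences I) (≡.trans (lookup∘tabulate _ (i ⊖ j))
  (dec-true (any? λ i′ → any? λ j′ → (i′ ∈? I) ×-dec (j′ ∈? I) ×-dec (i ⊖ j ≟ i′ ⊖ j′)) (i , j , i∈I , j∈I , ≡.refl)))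

2≤p^[2r+1] : ∀ {p} r → Prime p → 2 ℕ.≤ p ℕ.^ (2 ℕ.* r ℕ.+ 1)
2≤p^[2r+1] {p} r p-prime = begin
  2                           ≤⟨ ℕ.nonTrivial⇒n>1 p {{prime⇒nonTrivial p-prime}} ⟩
  p                           ≡⟨ ℕₚ.*-identityʳ p ⟨
  p ℕ.^ 1                     ≤⟨ ℕₚ.^-monoʳ-≤ p {{prime⇒nonZero p-prime}} (ℕₚ.m≤n+m 1 (2 ℕ.* r)) ⟩
  p ℕ.^ (2 ℕ.* r ℕ.+ 1)       ∎
  where open ℕₚ.≤-Reasoning

-- Quotients in the connection set and m-th powers, m = (q - 1) / d

module CayleyBound {c ℓ₁ ℓ₂ q′} (F : FiniteField c ℓ₁ ℓ₂ (suc q′))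
  (d m p r : ℕ) .{{_ : NonZero d}} .{{_ : NonZero p}} (p-prime : Prime p)
  (q≡ : suc q′ ≡ p ℕ.^ (2 ℕ.* r ℕ.+ 1)) (q′≡md : q′ ≡ m ℕ.* d) where
  open FiniteField F using (commutativeRing; size)
  open CommutativeRing commutativeRing hiding (zero)
  open Exp semiring using (_^_; ^-congˡ; ^-congʳ; ^-assocʳ; ^-homo-*)
  open import Data.Nat.DivMod using (_/_)
  open FiniteFieldProperties F
  open RingProperties ring
  open CExp commutativeSemiring using (^-distrib-*)

  1≤q′ : 1 ℕ.≤ q′
  1≤q′ = ℕ.s≤s⁻¹ (≡.subst (2 ℕ.≤_) (≡.sym q≡) (2≤p^[2r+1] r p-prime))

  instance
    m≢0 : NonZero m
    m≢0 = ℕ.≢-nonZero λ m≡0 → ℕₚ.<⇒≢ 1≤q′ (≡.sym (≡.trans q′≡md (≡.cong (ℕ._* d) m≡0)))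

  -- Differences in a clique lie in `S`, so `ratio` controls their quotients, and `length vs` < d
  -- gives N < q - 1. Then n ≤ (n - P) + P, where (n - P)² d is at most `length vs` times q - 1, and
  -- P² p = q.
  ω-bound : ∀ {s} (S : DecSubset setoid s) (vs : List Carrier) → All (λ v → ¬ v ≈ 0#) vs → length vs ℕ.< d →
    (∀ {s t} → DecSubset.Mem S s → DecSubset.Mem S t → ∀ y → s ≈ y * t → Any (λ v → y ^ m + v ≈ 0#) vs) →
    ⌜ ω (Cay F S) ⌝ ≤ᵘ √ ((+ (length vs ℕ.* suc q′)) ℚ./ d) +ᵘ √ ((+ suc q′) ℚ./ p)
  ω-bound S vs vs≉0 |vs|<d ratio = √-+-lower {a = n ∸ P} {b = P} (ℕₚ.≤-trans (ℕₚ.m≤n+m∸n n P) (ℕₚ.≤-reflexive (ℕₚ.+-comm P _)))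
    (begin
      (n ∸ P) ℕ.* (n ∸ P) ℕ.* d       ≤⟨ ℕₚ.*-monoˡ-≤ d (clique-bound p r p-prime q≡) ⟩
      length vs ℕ.* m ℕ.* d           ≡⟨ ≡.trans (ℕₚ.*-assoc (length vs) m d) (≡.cong (length vs ℕ.*_) (≡.sym q′≡md)) ⟩
      length vs ℕ.* q′                ≤⟨ ℕₚ.*-monoʳ-≤ (length vs) (ℕₚ.n≤1+n q′) ⟩
      length vs ℕ.* suc q′            ∎)
    (ℕₚ.≤-reflexive (≡.sym (≡.trans q≡ (≡.trans (ℕₚ.^-distribˡ-+-* p (2 ℕ.* r) 1)
      (≡.cong₂ ℕ._*_ (≡.trans (≡.cong (λ x → p ℕ.^ (r ℕ.+ x)) (ℕₚ.+-identityʳ r)) (ℕₚ.^-distribˡ-+-* p r r)) (ℕₚ.*-identityʳ p))))))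
    where
    open ℕₚ.≤-Reasoning
    X = Cay F S
    n = ω X
    P = p ℕ.^ r
    A : Fin n → Carrier
    A = proj₁ (proj₁ (proj₂ (cliqueNumber X)))
    clique : IsClique X A
    clique = proj₂ (proj₁ (proj₂ (cliqueNumber X)))
    N<q′ : length vs ℕ.* m ℕ.< q′
    N<q′ = ≡.subst (length vs ℕ.* m ℕ.<_) (≡.trans (ℕₚ.*-comm d m) (≡.sym q′≡md)) (ℕₚ.*-monoˡ-< m |vs|<d)
    open CliqueBound.Grid F A (λ i≢j → proj₁ (clique _ _ i≢j)) m vs vs≉0
      (λ i≢j k≢l → ratio (proj₂ (clique _ _ k≢l)) (proj₂ (clique _ _ i≢j))) N<q′ using (clique-bound)

  open import Relation.Binary.Reasoning.Setoid setoid

  -- Here h^m is some x^(q - 1). So the m-th power is constant on each coset of the d-th powers.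
  d-th-power^m≈1 : ∀ {h} → DecSubset.Mem (powers F d) h → h ^ m ≈ 1#
  d-th-power^m≈1 {h} (x , x≉0 , h≈xᵈ) = begin
    h ^ m           ≈⟨ ^-congˡ m h≈xᵈ ⟩
    (x ^ d) ^ m     ≈⟨ ^-assocʳ x d m ⟩
    x ^ (d ℕ.* m)   ≈⟨ ^-congʳ x (≡.trans (ℕₚ.*-comm d m) (≡.sym q′≡md)) ⟩
    x ^ q′          ≈⟨ fermat-unit 1≤q′ x≉0 ⟩
    1#              ∎

  module _ {γ} (γᵈ≈1 : γ ^ d ≈ 1#) where

    ^-% : ∀ e → γ ^ (e % d) ≈ γ ^ e
    ^-% e = begin
      γ ^ (e % d)                              ≈⟨ *-identityʳ _ ⟨
      γ ^ (e % d) * 1#                         ≈⟨ *-congˡ (periods (e / d)) ⟨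
      γ ^ (e % d) * γ ^ (e / d ℕ.* d)          ≈⟨ ^-homo-* γ (e % d) (e / d ℕ.* d) ⟨
      γ ^ (e % d ℕ.+ e / d ℕ.* d)              ≈⟨ ^-congʳ γ (m≡m%n+[m/n]*n e d) ⟨
      γ ^ e                                    ∎
      where
      periods : ∀ k → γ ^ (k ℕ.* d) ≈ 1#
      periods zero    = refl
      periods (suc k) = trans (^-homo-* γ d (k ℕ.* d)) (trans (*-cong γᵈ≈1 (periods k)) (*-identityˡ 1#))

    -- Exponents of γ count modulo d, so `⊖` corresponds to division of powers.
    ^-⊖ : (i j : Fin d) → γ ^ toℕ (i ⊖ j) * γ ^ toℕ j ≈ γ ^ toℕ i
    ^-⊖ i j = begin
      γ ^ toℕ (i ⊖ j) * γ ^ toℕ j                            ≈⟨ *-congʳ (^-congʳ γ (Finₚ.toℕ-fromℕ< (m%n<n (toℕ i ℕ.+ (d ∸ toℕ j)) d))) ⟩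
      γ ^ ((toℕ i ℕ.+ (d ∸ toℕ j)) % d) * γ ^ toℕ j          ≈⟨ *-congʳ (^-% (toℕ i ℕ.+ (d ∸ toℕ j))) ⟩
      γ ^ (toℕ i ℕ.+ (d ∸ toℕ j)) * γ ^ toℕ j                ≈⟨ ^-homo-* γ (toℕ i ℕ.+ (d ∸ toℕ j)) (toℕ j) ⟨
      γ ^ (toℕ i ℕ.+ (d ∸ toℕ j) ℕ.+ toℕ j)                  ≈⟨ ^-congʳ γ (≡.trans (ℕₚ.+-assoc (toℕ i) _ _) (≡.cong (toℕ i ℕ.+_) (ℕₚ.m∸n+n≡m (ℕₚ.<⇒≤ (Finₚ.toℕ<n j))))) ⟩
      γ ^ (toℕ i ℕ.+ d)                                      ≈⟨ ^-homo-* γ (toℕ i) d ⟩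
      γ ^ toℕ i * γ ^ d                                      ≈⟨ trans (*-congˡ γᵈ≈1) (*-identityʳ _) ⟩
      γ ^ toℕ i                                              ∎

  -x≉0 : ∀ {x} → ¬ x ≈ 0# → ¬ - x ≈ 0#
  -x≉0 x≉0 -x≈0 = x≉0 (trans (sym (-‿involutive _)) (trans (-‿cong -x≈0) -0#≈0#))

  ω-powers-bound : 2 ℕ.≤ d → ⌜ ω (GP F d) ⌝ ≤ᵘ √ ((+ suc q′) ℚ./ d) +ᵘ √ ((+ suc q′) ℚ./ p)
  ω-powers-bound 2≤d = ≡.subst (λ S → ⌜ ω (GP F d) ⌝ ≤ᵘ √ ((+ S) ℚ./ d) +ᵘ √ ((+ suc q′) ℚ./ p)) (ℕₚ.*-identityˡ (suc q′))
    -- A quotient of d-th powers has m-th power 1, so one value suffices, and 1 < d.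
    (ω-bound (powers F d) (- 1# ∷ []) (-x≉0 (1≉0 1≤q′) ∷ []) 2≤d λ {s} {t} s∈H t∈H y s≈yt → here (x≈y⇒x∙y⁻¹≈ε (begin
      y ^ m              ≈⟨ *-identityʳ _ ⟨
      y ^ m * 1#         ≈⟨ *-congˡ (d-th-power^m≈1 t∈H) ⟨
      y ^ m * t ^ m      ≈⟨ ^-distrib-* y t m ⟨
      (y * t) ^ m        ≈⟨ ^-congˡ m s≈yt ⟨
      s ^ m              ≈⟨ d-th-power^m≈1 s∈H ⟩
      1#                 ∎)))

  -- With γ = g^m the m-th power maps the coset of g^i to γ^i, so a quotient of elements from cosets
  -- i and j goes to γ^(i - j). The values are the γ^k with k in I - I, fewer than d since I - I is
  -- not everything.
  ω-cosets-bound : ∀ {g} → ¬ g ≈ 0# → (I : Subset d) → differences I ≢ ⊤ →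
    ⌜ ω (Cay F (cosets F d g I)) ⌝ ≤ᵘ √ ((+ (∣ differences I ∣ ℕ.* suc q′)) ℚ./ d) +ᵘ √ ((+ suc q′) ℚ./ p)
  ω-cosets-bound {g} g≉0 I I-I≢⊤ = ≡.subst (λ l → ⌜ ω (Cay F (cosets F d g I)) ⌝ ≤ᵘ √ ((+ (l ℕ.* suc q′)) ℚ./ d) +ᵘ √ ((+ suc q′) ℚ./ p)) |vs|
    (ω-bound (cosets F d g I) vs
      (Allₚ.map⁺ (All.universal (λ k → -x≉0 (^-≉0 1≤q′ (toℕ k) (^-≉0 1≤q′ m g≉0))) (members (differences I))))
      (≡.subst (ℕ._< d) (≡.sym |vs|) (ℕₚ.≤∧≢⇒< (∣p∣≤n (differences I)) (I-I≢⊤ ∘ ∣p∣≡n⇒p≡⊤))) ratio)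
    where
    γ = g ^ m
    γᵈ≈1 : γ ^ d ≈ 1#
    γᵈ≈1 = trans (^-assocʳ g m d) (trans (^-congʳ g (≡.sym q′≡md)) (fermat-unit 1≤q′ g≉0))
    vs : List Carrier
    vs = map (λ k → - (γ ^ toℕ k)) (members (differences I))
    |vs| : length vs ≡ ∣ differences I ∣
    |vs| = ≡.trans (length-map _ (members (differences I))) (length-members (differences I))
    coset^m : ∀ i {s h} → DecSubset.Mem (powers F d) h → s ≈ g ^ toℕ i * h → s ^ m ≈ γ ^ toℕ i
    coset^m i {s} {h} h∈H s≈gⁱh = begin
      s ^ m                       ≈⟨ ^-congˡ m s≈gⁱh ⟩
      (g ^ toℕ i * h) ^ m         ≈⟨ ^-distrib-* (g ^ toℕ i) h m ⟩
      (g ^ toℕ i) ^ m * h ^ m     ≈⟨ *-cong (trans (^-assocʳ g (toℕ i) m) (trans (^-congʳ g (ℕₚ.*-comm (toℕ i) m)) (sym (^-assocʳ g m (toℕ i))))) (d-th-power^m≈1 h∈H) ⟩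
      γ ^ toℕ i * 1#              ≈⟨ *-identityʳ _ ⟩
      γ ^ toℕ i                   ∎
    ratio : ∀ {s t} → DecSubset.Mem (cosets F d g I) s → DecSubset.Mem (cosets F d g I) t →
      ∀ y → s ≈ y * t → Any (λ v → y ^ m + v ≈ 0#) vs
    ratio {s} {t} (i , i∈I , _ , h∈H , s≈) (j , j∈I , _ , h′∈H , t≈) y s≈yt =
      -- Multiplying by the nonzero γ^j avoids forming the inverse of t.
      Anyₚ.map⁺ (lose (∈-members (∈-differences i∈I j∈I)) (*-cancel-0 (^-≉0 1≤q′ (toℕ j) (^-≉0 1≤q′ m g≉0)) (begin
        γ ^ toℕ j * (y ^ m - γ ^ toℕ (i ⊖ j))                    ≈⟨ trans (*-comm _ _) ([y-z]x≈yx-zx _ _ _) ⟩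
        y ^ m * γ ^ toℕ j - γ ^ toℕ (i ⊖ j) * γ ^ toℕ j          ≈⟨ x≈y⇒x∙y⁻¹≈ε (begin
          y ^ m * γ ^ toℕ j                     ≈⟨ *-congˡ (coset^m j h′∈H t≈) ⟨
          y ^ m * t ^ m                         ≈⟨ ^-distrib-* y t m ⟨
          (y * t) ^ m                           ≈⟨ ^-congˡ m s≈yt ⟨
          s ^ m                                 ≈⟨ coset^m i h∈H s≈ ⟩
          γ ^ toℕ i                             ≈⟨ ^-⊖ γᵈ≈1 i j ⟨
          γ ^ toℕ (i ⊖ j) * γ ^ toℕ j           ∎) ⟩
        0#                                                       ∎)))

-- The bounds for unions of cosets and for Paley graphs

open import Data.Nat.Base using (ℕ; _+_; _*_; _∸_; _^_; _≤_; NonZero)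
open import Data.Rational.Base using (_/_)

corollary1p3 : ∀ {c ℓ₁ ℓ₂} (d p r q : ℕ) .{{_ : NonZero d}} .{{_ : NonZero p}} →
    2 ≤ d → Prime p → q ≡ p ^ (2 * r + 1) → d ∣ q ∸ 1 →
    (F : FiniteField c ℓ₁ ℓ₂ q) →
    ( (g : FiniteField.Carrier F) → IsPrimitiveRoot F g →
    (I : Subset d) →
    DecSubset.Mem (cosets F d g I) ≐ negation F (DecSubset.Mem (cosets F d g I)) →
    differences I ≢ ⊤ →
    ⌜ ω (Cay F (cosets F d g I)) ⌝ ≤ᵘ √ ((+ (∣ differences I ∣ * q)) / d) +ᵘ √ ((+ q) / p) )
    ×
    ( (2 ∤ q → 2 * d ∣ q ∸ 1) →
    ⌜ ω (GP F d) ⌝ ≤ᵘ √ ((+ q) / d) +ᵘ √ ((+ q) / p) )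
-- q is at least 2, so it may be written as `suc q′`; then m is the quotient of q′ = q - 1 by d.
corollary1p3 d p r zero 2≤d p-prime q≡ d∣q-1 F =
  contradiction (≡.subst (2 ≤_) (≡.sym q≡) (2≤p^[2r+1] r p-prime)) λ ()
corollary1p3 d p r (suc q′) 2≤d p-prime q≡ (divides m q′≡md) F =
  (λ g (g≉0 , _) I _ I-I≢⊤ → ω-cosets-bound g≉0 I I-I≢⊤) , (λ _ → ω-powers-bound 2≤d)
  where open CayleyBound F d m p r p-prime q≡ q′≡md
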